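{- Let $G$ be a graph and let $d\ge 2$ be an integer. Given a tree decomposition $\mathcal{T}$ and a layering $(V_1,V_2,\ldots)$ of $G$ witnessing layered treewidth $k$, it is possible to compute, in time $\mathcal{O}(|\mathcal{T}|\cdot(|V(G)|+|E(G)|))$, a tree decomposition $\mathcal{T}^d$ with $|\mathcal{T}^d|=|\mathcal{T}|$ and a layering of the graph $G^d$ witnessing layered tree-independence number $2dk$ if $d$ is even, and $(2d-1)k$ if $d$ is odd.
   Context: All graphs are finite and simple; $\alpha$ denotes the independence number. The $d$-th power $G^d$ has vertex set $V(G)$, with distinct $u,v$ adjacent iff they are at distance at most $d$ in $G$. A tree decomposition of $G$ is a pair $\mathcal{T}=(T,\{X_t\}_{t\in V(T)})$ with $T$ a tree and bags $X_t\subseteq V(G)$ such that every vertex is in some bag, both endpoints of every edge lie in a common bag, and for each $u\in V(G)$ the nodes $t$ with $u\in X_t$ induce a connected subgraph of $T$; $|\mathcal{T}|=|V(T)|$. A layering of $G$ is an ordered partition $(V_1,V_2,\ldots)$ of $V(G)$ (parts may be empty, all but finitely many are) such that for each edge $uv$ with $u\in V_i$, $v\in V_j$ we have $|i-j|\le 1$. A tree decomposition $(T,\{X_t\})$ and a layering $(V_1,V_2,\ldots)$ of a graph witness layered treewidth (resp. layered tree-independence number) $\ell$ if $|X_t\cap V_i|\le\ell$ (resp. the subgraph induced by $X_t\cap V_i$ has independence number at most $\ell$) for every bag $X_t$ and layer $V_i$. -}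

module Defs where

open import Level using (0ℓ)
open import Data.Bool using (if_then_else_)
open import Data.Fin using (Fin; toℕ; _<?_)
open import Data.Fin.Properties using (all?; any?; _≟_)
open import Data.Fin.Subset using (Subset; inside; outside; _∩_; ∣_∣; _∈_; _⊆_)
open import Data.Fin.Subset.Properties using (_∈?_; _⊆?_)
open import Data.List using (List; []; _∷_; _++_; map; filter; length; lookup; allFin; cartesianProduct)
open import Data.List.Extrema.Nat using (max)
import Data.List.Membership.Propositional as List
open import Data.List.Relation.Unary.Linked using (Linked)
open import Data.List.Relation.Unary.Unique.Propositional using (Unique)
open import Data.Nat using (ℕ; zero; suc; _+_; _∸_; _/_; _≤_; ∣_-_∣; _≡ᵇ_; s≤s)
open import Data.Nat.Properties using (anyUpTo?; ≤-pred)
open import Data.Product using (Σ-syntax; ∃-syntax; _×_; _,_; proj₁; proj₂)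
import Data.Vec as Vec
open import Function.Bundles using (_⇔_)
open import Relation.Binary using (Rel; Decidable; Symmetric)
open import Relation.Binary.Construct.Closure.ReflexiveTransitive using (Star)
open import Relation.Binary.PropositionalEquality using (_≡_; _≢_; refl; ≢-sym)
open import Relation.Nullary using (¬_; Dec)
open import Relation.Nullary.Decidable using (map′; _×-dec_; _→-dec_; ¬?)
open import Relation.Unary using (Pred; U)

record Graph (n : ℕ) : Set₁ where
  infix 4 _~_ _~?_
  field
    _~_     : Rel (Fin n) 0ℓ
    _~?_    : Decidable _~_
    ~-sym   : Symmetric _~_
    ~-irrefl : ∀ {u} → ¬ (u ~ u)

module _ {n : ℕ} (G : Graph n) where
  open Graph G

  -- Each edge is counted once, as the pair (u , v) with u < v.
  ∣E∣ : ℕ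
  ∣E∣ = length (filter (λ p → (proj₁ p <? proj₂ p) ×-dec (proj₁ p ~? proj₂ p))
                       (cartesianProduct (allFin n) (allFin n)))

  Walk : ℕ → Rel (Fin n) 0ℓ
  Walk zero    u v = u ≡ v
  Walk (suc l) u v = ∃[ w ] (u ~ w × Walk l w v)

  DistAtMost : ℕ → Rel (Fin n) 0ℓ
  DistAtMost d u v = ∃[ l ] (l ≤ d × Walk l u v)

  walk? : ∀ l → Decidable (Walk l)
  walk? zero    u v = u ≟ v
  walk? (suc l) u v = any? λ w → (u ~? w) ×-dec walk? l w v

  distAtMost? : ∀ d → Decidable (DistAtMost d)
  distAtMost? d u v =
    map′ (λ (l , l<1+d , w) → l , ≤-pred l<1+d , w)
         (λ (l , l≤d , w) → l , s≤s l≤d , w)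
         (anyUpTo? (λ l → walk? l u v) (suc d))

  walk-snoc : ∀ l {u v w} → Walk l u v → v ~ w → Walk (suc l) u w
  walk-snoc zero    refl          v~w = _ , v~w , refl
  walk-snoc (suc l) (x , u~x , p) v~w = x , u~x , walk-snoc l p v~w

  walk-sym : ∀ l → Symmetric (Walk l)
  walk-sym zero    refl          = refl
  walk-sym (suc l) (x , u~x , p) = walk-snoc l (walk-sym l p) (~-sym u~x)

  power : ℕ → Graph n
  power d = record
    { _~_      = λ u v → u ≢ v × DistAtMost d u v
    ; _~?_     = λ u v → ¬? (u ≟ v) ×-dec distAtMost? d u v
    ; ~-sym    = λ (u≢v , l , l≤d , p) → ≢-sym u≢v , l , l≤d , walk-sym l p
    ; ~-irrefl = λ (u≢u , _) → u≢u refl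
    }

  Independent : Subset n → Set
  Independent S = ∀ u v → u ∈ S → v ∈ S → ¬ (u ~ v)

  independent? : ∀ S → Dec (Independent S)
  independent? S = all? λ u → all? λ v → (u ∈? S) →-dec ((v ∈? S) →-dec ¬? (u ~? v))

  -- P induces a connected subgraph: walks must stay inside P.
  ConnectedOn : Pred (Fin n) 0ℓ → Set
  ConnectedOn P = ∀ {s t} → P s → P t → Star (λ a b → a ~ b × P a × P b) s t

  -- A cycle is x, y₁, …, yₖ, x with k ≥ 2 and x, y₁, …, yₖ distinct.
  Acyclic : Set
  Acyclic = ∀ x ys → 2 ≤ length ys → Unique (x ∷ ys) → ¬ Linked _~_ (x ∷ ys ++ x ∷ [])

  record IsTree : Set where
    field
      nonempty  : 1 ≤ n
      connected : ConnectedOn U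
      acyclic   : Acyclic

subsets : ∀ n → List (Subset n)
subsets zero    = Vec.[] ∷ []
subsets (suc n) = map (inside Vec.∷_) (subsets n) ++ map (outside Vec.∷_) (subsets n)

-- The independence number of the subgraph of G induced by S.  The default 0 of
-- max is harmless, since the empty set is always independent.
α : ∀ {n} → Graph n → Subset n → ℕ
α {n} G S = max 0 (map ∣_∣ (filter (λ I → (I ⊆? S) ×-dec independent? G I) (subsets n)))

record TreeDecomposition {n : ℕ} (G : Graph n) : Set₁ where
  open Graph G
  field
    size   : ℕ
    tree   : Graph size
    isTree : IsTree tree
    bag    : Fin size → Subset n
    vertexCovered : ∀ v → ∃[ t ] v ∈ bag t
    edgeCovered   : ∀ {u v} → u ~ v → ∃[ t ] (u ∈ bag t × v ∈ bag t)
    connected     : ∀ u → ConnectedOn tree (λ t → u ∈ bag t)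

-- The parts are indexed from 0 rather than 1.  All but finitely many are empty
-- because they are disjoint subsets of a finite set.
record Layering {n : ℕ} (G : Graph n) : Set where
  open Graph G
  field
    part     : ℕ → Subset n
    covering : ∀ v → ∃[ i ] v ∈ part i
    disjoint : ∀ {v i j} → v ∈ part i → v ∈ part j → i ≡ j
    edgeSpan : ∀ {u v i j} → u ~ v → u ∈ part i → v ∈ part j → ∣ i - j ∣ ≤ 1

module _ {n : ℕ} {G : Graph n} (𝒯 : TreeDecomposition G) (ℒ : Layering G) where
  open TreeDecomposition 𝒯
  open Layering ℒ

  WitnessLayeredTreewidth : ℕ → Set
  WitnessLayeredTreewidth ℓ = ∀ t i → ∣ bag t ∩ part i ∣ ≤ ℓ

  WitnessLayeredTreeIndependence : ℕ → Set
  WitnessLayeredTreeIndependence ℓ = ∀ t i → α G (bag t ∩ part i) ≤ ℓ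

-- A random access machine given by structured programs over natural-number
-- registers and arrays, where division by zero returns zero.  Each executed
-- operation, including each operation inside an expression, takes one time unit.
-- Addition and multiplication are deliberately not primitive: the result of an
-- operation exceeds the largest argument by at most 1, so no number exceeds the largest number
-- initially in memory or in the program by more than the running time, and
-- unit cost cannot be exploited by building up huge numbers.

Var Arr : Set
Var = ℕ
Arr = ℕ

record State : Set where
  constructor state
  field
    var : Var → ℕ
    arr : Arr → ℕ → ℕ

open State public

data Expr : Set where
  lit  : ℕ → Expr
  reg  : Var → Expr
  _[_] : Arr → Expr → Expr
  inc  : Expr → Expr
  _⊖_  : Expr → Expr → Expr
  _⊘_  : Expr → Expr → Expr

data Cmd : Set where
  skip   : Cmd
  _≔_    : Var → Expr → Cmd
  _[_]≔_ : Arr → Expr → Expr → Cmd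
  _⨾_    : Cmd → Cmd → Cmd
  if     : Expr → Cmd → Cmd → Cmd
  while  : Expr → Cmd → Cmd

infix  9 _[_]
infixl 6 _⊖_
infixl 7 _⊘_
infix  5 _≔_ _[_]≔_
infixr 4 _⨾_

div : ℕ → ℕ → ℕ
div m zero    = 0
div m (suc n) = m / suc n

⟦_⟧ : Expr → State → ℕ
⟦ lit k ⟧   σ = k
⟦ reg x ⟧   σ = var σ x
⟦ a [ e ] ⟧ σ = arr σ a (⟦ e ⟧ σ)
⟦ inc e ⟧   σ = suc (⟦ e ⟧ σ)
⟦ e ⊖ f ⟧   σ = ⟦ e ⟧ σ ∸ ⟦ f ⟧ σ
⟦ e ⊘ f ⟧   σ = div (⟦ e ⟧ σ) (⟦ f ⟧ σ)

cost : Expr → ℕ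
cost (lit k)   = 1
cost (reg x)   = 1
cost (a [ e ]) = suc (cost e)
cost (inc e)   = suc (cost e)
cost (e ⊖ f)   = suc (cost e + cost f)
cost (e ⊘ f)   = suc (cost e + cost f)

update : ∀ {A : Set} → (ℕ → A) → ℕ → A → ℕ → A
update f i a j = if j ≡ᵇ i then a else f j

setVar : State → Var → ℕ → State
setVar σ x v = state (update (var σ) x v) (arr σ)

setArr : State → Arr → ℕ → ℕ → State
setArr σ a i v = state (var σ) (update (arr σ) a (update (arr σ a) i v))

-- Run c σ τ s: started in σ, the program c halts in τ after s time units.
-- A test succeeds when its value is nonzero.
data Run : Cmd → State → State → ℕ → Set where
  run-skip   : ∀ {σ} → Run skip σ σ 1
  run-var    : ∀ {x e σ} → Run (x ≔ e) σ (setVar σ x (⟦ e ⟧ σ)) (suc (cost e))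
  run-arr    : ∀ {a e f σ} →
               Run (a [ e ]≔ f) σ (setArr σ a (⟦ e ⟧ σ) (⟦ f ⟧ σ)) (suc (cost e + cost f))
  run-seq    : ∀ {c₁ c₂ σ ρ τ s₁ s₂} →
               Run c₁ σ ρ s₁ → Run c₂ ρ τ s₂ → Run (c₁ ⨾ c₂) σ τ (s₁ + s₂)
  run-then   : ∀ {e c₁ c₂ σ τ s} → ⟦ e ⟧ σ ≢ 0 →
               Run c₁ σ τ s → Run (if e c₁ c₂) σ τ (suc (cost e + s))
  run-else   : ∀ {e c₁ c₂ σ τ s} → ⟦ e ⟧ σ ≡ 0 →
               Run c₂ σ τ s → Run (if e c₁ c₂) σ τ (suc (cost e + s))
  run-done   : ∀ {e c σ} → ⟦ e ⟧ σ ≡ 0 → Run (while e c) σ σ (suc (cost e))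
  run-repeat : ∀ {e c σ ρ τ s₁ s₂} → ⟦ e ⟧ σ ≢ 0 →
               Run c σ ρ s₁ → Run (while e c) ρ τ s₂ →
               Run (while e c) σ τ (suc (cost e + (s₁ + s₂)))

-- The sets P 0, …, P (m - 1) are written one after another in the array elts,
-- each as a duplicate-free list in arbitrary order; the list for P i occupies
-- positions offs[i], …, offs[i + 1] - 1.
StoresSets : State → Arr → Arr → ∀ {m n} → (Fin m → Pred (Fin n) 0ℓ) → Set
StoresSets σ offs elts {m} {n} P =
  Σ[ list ∈ (Fin m → List (Fin n)) ]
    ( (∀ i → Unique (list i))
    × (∀ i v → (v List.∈ list i) ⇔ P i v)
    × arr σ offs 0 ≡ 0
    × (∀ i → arr σ offs (suc (toℕ i)) ≡ arr σ offs (toℕ i) + length (list i))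
    × (∀ i j → arr σ elts (arr σ offs (toℕ i) + toℕ j) ≡ toℕ (lookup (list i) j)))

vertexCount nodeCount exponent : Var
vertexCount = 0
nodeCount   = 1
exponent    = 2

adjOffs adjElts treeOffs treeElts bagOffs bagElts layer : Arr
adjOffs  = 0
adjElts  = 1
treeOffs = 2
treeElts = 3
bagOffs  = 4
bagElts  = 5
layer    = 6

StoresGraph : State → ∀ {n} → Graph n → Set
StoresGraph σ {n} G = var σ vertexCount ≡ n × StoresSets σ adjOffs adjElts (Graph._~_ G)

StoresDecomposition : State → ∀ {n} {G : Graph n} → TreeDecomposition G → Set
StoresDecomposition σ 𝒯 =
    var σ nodeCount ≡ size
  × StoresSets σ treeOffs treeElts (Graph._~_ tree)
  × StoresSets σ bagOffs bagElts (λ t v → v ∈ bag t)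
  where open TreeDecomposition 𝒯

StoresLayering : State → ∀ {n} {G : Graph n} → Layering G → Set
StoresLayering σ ℒ = ∀ {v i} → v ∈ part i → arr σ layer (toℕ v) ≡ i
  where open Layering ℒ

{-# OPTIONS --safe #-}

-- With r = ⌊d / 2⌋, the new bag of t is the ball of radius r around X_t, and the
-- new layers are blocks of d consecutive old layers.  A path of length at most
-- d ≤ 2r + 1 splits at an edge into two pieces of length at most r, and that edge
-- lies in a bag; since balls are connected, so are the sets of nodes.  Two distinct
-- vertices of an independent set of G^d cannot share a centre, because 2r ≤ d, so
-- an independent set inside one new bag and layer injects into the vertices of X_t
-- in d + 2r consecutive old layers; d + 2r is 2d for even and 2d - 1 for odd d.
--
-- The balls are found by a breadth-first search from each bag, cut off after r
-- rounds or when a round finds nothing new.  Each search costs O(|V| + |E|), as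
-- every vertex is processed at most once; in particular the cost does not depend on d.
module Submission where

open import Defs
open import Level using (0ℓ)
open import Data.Bool using (Bool; true; false; not; T)
open import Data.Empty using (⊥-elim)
open import Data.Fin as Fin using (Fin; zero; suc; toℕ)
import Data.Fin.Properties as Fin
open import Data.Fin.Subset using (Subset; inside; outside; _∈_; _⊆_; _∩_) renaming (∣_∣ to card)
open import Data.Fin.Subset.Properties using (x∈p∩q⁺; x∈p∩q⁻; _∈?_; _⊆?_)
open import Data.List using (List; []; _∷_; _++_; map; filter; length; lookup; allFin; cartesianProduct; concat; upTo)
open import Data.List.Extrema.Nat using (max≤v⁺)
import Data.List.Membership.Propositional as List
open import Data.List.Membership.Propositional.Properties
  using (∈-allFin; ∈-∃++; ∈-++⁺ˡ; ∈-++⁺ʳ; ∈-++⁻; ∈-map⁺; ∈-map⁻; ∈-filter⁺; ∈-filter⁻;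
         ∈-cartesianProduct⁺; ∈-concat⁺′; ∈-upTo⁺)
open import Data.List.Properties
  using (length-map; length-++; length-tabulate; length-upTo; map-++; filter-++; ++-assoc; ++-identityʳ)
open import Data.List.Relation.Unary.All as All using ([]; _∷_)
import Data.List.Relation.Unary.All.Properties as All
open import Data.List.Relation.Unary.AllPairs using ([]; _∷_)
open import Data.List.Relation.Unary.Any using (here; there)
open import Data.List.Relation.Unary.Unique.Propositional using (Unique)
import Data.List.Relation.Unary.Unique.Propositional.Properties as Unique
open import Data.Nat
open import Data.Nat.Divisibility using (_∣_; _∤_; ∣-refl; m%n≡0⇒n∣m)
open import Data.Nat.DivMod using (/-monoˡ-≤; n/n≡1; +-distrib-/-∣ʳ; m/n*n≤m; m/n*n≡m; m≡m%n+[m/n]*n; m%n<n)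
open import Data.Nat.ListAction using (sum)
open import Data.Nat.ListAction.Properties using (sum-++)
open import Data.Nat.Properties
open import Data.Nat.Tactic.RingSolver using (solve-∀)
open import Data.Product using (Σ-syntax; ∃-syntax; _×_; _,_; proj₁; proj₂; swap)
open import Data.Sum using (_⊎_; inj₁; inj₂)
open import Data.Unit using (⊤; tt)
import Data.Vec as Vec
open import Data.Vec.Properties using ([]=⇒lookup; lookup⇒[]=; lookup∘tabulate)
open import Function using (_∘_; id; const)
open import Function.Bundles using (_⇔_; mk⇔; Equivalence)
open import Relation.Binary using (Symmetric; tri<; tri≈; tri>)
open import Relation.Binary.Construct.Closure.ReflexiveTransitive as Star using (Star; _◅◅_)
open import Relation.Binary.PropositionalEquality hiding ([_])
open import Relation.Nullary using (¬_; yes; no; does)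
open import Relation.Nullary.Decidable using (_×-dec_; dec-true)
open import Relation.Unary using (Pred; Decidable)

-- The radius is forced. Covering the edges of the power needs d ≤ 2r + 1, and separating the
-- centres of an independent set needs 2r ≤ d; ⌊d / 2⌋ is the only integer that meets both. Likewise
-- d is the least block length for which an edge of the power always moves by at most one block. The
-- power graph is never built, since it can have quadratically many edges. The program only replaces
-- bags and layers, and the tree stays in place. The combinatorial half fixes the new bags and parts
-- without reference to the machine; the program half shows that these very sets end up in memory.
-- Its invariants speak of balls, so no distances are stored.

-- Counting along injections, and the handshake bound.

-- A relation replaces an injective function because an element may have several partners, as a
-- vertex may have several centres; only a partner must determine its element. The partner `y` of
-- the head is deleted from `ys`, and by injectivity no later element is related to it.
sum-map-≤ : ∀ {A B : Set} (f : A → ℕ) (g : B → ℕ) (R : A → B → Set) {xs ys} → Unique xs →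
            (∀ {x} → x List.∈ xs → ∃[ y ] (y List.∈ ys × R x y × f x ≤ g y)) →
            (∀ {x x′ y} → x List.∈ xs → x′ List.∈ xs → R x y → R x′ y → x ≡ x′) →
            sum (map f xs) ≤ sum (map g ys)
sum-map-≤ f g R [] image inj = z≤n
sum-map-≤ f g R {x ∷ xs} (x∉xs ∷ uniq) image inj
  with y , y∈ys , Rxy , fx≤gy ← image (here refl)
  with as , bs , refl ← ∈-∃++ y∈ys = begin
    f x + sum (map f xs)                          ≤⟨ +-mono-≤ fx≤gy (sum-map-≤ f g R uniq image′ λ p q → inj (there p) (there q)) ⟩
    g y + sum (map g (as ++ bs))                  ≡⟨ cong (λ l → g y + sum l) (map-++ g as bs) ⟩
    g y + sum (map g as ++ map g bs)              ≡⟨ cong (g y +_) (sum-++ (map g as) _) ⟩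
    g y + (sum (map g as) + sum (map g bs))       ≡⟨ +-assoc (g y) _ _ ⟨
    g y + sum (map g as) + sum (map g bs)         ≡⟨ cong (_+ sum (map g bs)) (+-comm (g y) _) ⟩
    sum (map g as) + g y + sum (map g bs)         ≡⟨ +-assoc (sum (map g as)) _ _ ⟩
    sum (map g as) + (g y + sum (map g bs))       ≡⟨ sum-++ (map g as) _ ⟨
    sum (map g as ++ map g (y ∷ bs))              ≡⟨ cong sum (map-++ g as (y ∷ bs)) ⟨
    sum (map g (as ++ y ∷ bs))                    ∎
  where
  open ≤-Reasoning
  image′ : ∀ {x′} → x′ List.∈ xs → ∃[ y′ ] (y′ List.∈ as ++ bs × R x′ y′ × f x′ ≤ g y′)
  image′ x′∈xs with y′ , y′∈ , Rx′y′ , le ← image (there x′∈xs) with ∈-++⁻ as y′∈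
  ... | inj₁ p           = y′ , ∈-++⁺ˡ p , Rx′y′ , le
  ... | inj₂ (there p)   = y′ , ∈-++⁺ʳ as p , Rx′y′ , le
  ... | inj₂ (here refl) = ⊥-elim (All.lookup x∉xs x′∈xs (inj (here refl) (there x′∈xs) Rxy Rx′y′))

sum-map-1 : ∀ {A : Set} (xs : List A) → sum (map (const 1) xs) ≡ length xs
sum-map-1 []       = refl
sum-map-1 (x ∷ xs) = cong suc (sum-map-1 xs)

length-≤ : ∀ {A B : Set} (R : A → B → Set) {xs ys} → Unique xs →
           (∀ {x} → x List.∈ xs → ∃[ y ] (y List.∈ ys × R x y)) →
           (∀ {x x′ y} → x List.∈ xs → x′ List.∈ xs → R x y → R x′ y → x ≡ x′) →
           length xs ≤ length ys
length-≤ R {xs} {ys} uniq image inj = subst₂ _≤_ (sum-map-1 xs) (sum-map-1 ys)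
  (sum-map-≤ (const 1) (const 1) R uniq
    (λ x∈xs → let y , y∈ys , Rxy = image x∈xs in y , y∈ys , Rxy , ≤-refl) inj)

unique-⊆-sum : ∀ {A : Set} (f : A → ℕ) {xs ys} → Unique xs → (∀ {x} → x List.∈ xs → x List.∈ ys) →
               sum (map f xs) ≤ sum (map f ys)
unique-⊆-sum f uniq sub =
  sum-map-≤ f f _≡_ uniq (λ {x} x∈xs → x , sub x∈xs , refl , ≤-refl) (λ _ _ p q → trans p (sym q))

unique-⊆-length : ∀ {A : Set} {xs ys : List A} → Unique xs → (∀ {x} → x List.∈ xs → x List.∈ ys) →
                  length xs ≤ length ys
unique-⊆-length uniq sub =
  length-≤ _≡_ uniq (λ {x} x∈xs → x , sub x∈xs , refl) (λ _ _ p q → trans p (sym q))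

length-allFin : ∀ n → length (allFin n) ≡ n
length-allFin n = length-tabulate {n = n} id

unique-length : ∀ {n} {xs : List (Fin n)} → Unique xs → length xs ≤ n
unique-length {n} {xs} uniq = subst (length xs ≤_) (length-allFin n) (unique-⊆-length uniq (λ _ → ∈-allFin _))

sum-map-mono : ∀ {A : Set} {f g : A → ℕ} → (∀ x → f x ≤ g x) → ∀ xs → sum (map f xs) ≤ sum (map g xs)
sum-map-mono f≤g []       = z≤n
sum-map-mono f≤g (x ∷ xs) = +-mono-≤ (f≤g x) (sum-map-mono f≤g xs)

length-filter-map : ∀ {A B : Set} {P : Pred B 0ℓ} (P? : Decidable P) (f : A → B) xs →
                    length (filter P? (map f xs)) ≡ length (filter (P? ∘ f) xs)
length-filter-map P? f []       = refl
length-filter-map P? f (x ∷ xs) with does (P? (f x))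
... | true  = cong suc (length-filter-map P? f xs)
... | false = length-filter-map P? f xs

length-filter-cartesianProduct :
  ∀ {A B : Set} {P : Pred (A × B) 0ℓ} (P? : Decidable P) xs ys →
  length (filter P? (cartesianProduct xs ys)) ≡ sum (map (λ x → length (filter (λ y → P? (x , y)) ys)) xs)
length-filter-cartesianProduct P? []       ys = refl
length-filter-cartesianProduct P? (x ∷ xs) ys = begin
  length (filter P? (map (x ,_) ys ++ cartesianProduct xs ys))
    ≡⟨ cong length (filter-++ P? (map (x ,_) ys) _) ⟩
  length (filter P? (map (x ,_) ys) ++ filter P? (cartesianProduct xs ys))
    ≡⟨ length-++ (filter P? (map (x ,_) ys)) ⟩
  length (filter P? (map (x ,_) ys)) + length (filter P? (cartesianProduct xs ys))
    ≡⟨ cong₂ _+_ (length-filter-map P? (x ,_) ys) (length-filter-cartesianProduct P? xs ys) ⟩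
  length (filter (λ y → P? (x , y)) ys) + sum (map (λ x → length (filter (λ y → P? (x , y)) ys)) xs)
    ∎
  where open ≡-Reasoning

module _ {n : ℕ} (G : Graph n) where
  open Graph G

  -- An upper bound suffices for the running time. By trichotomy every arc is an edge or a reversed
  -- edge, loops being excluded by irreflexivity.
  handshake : (adj : Fin n → List (Fin n)) → (∀ v → Unique (adj v)) →
              (∀ v w → (w List.∈ adj v) ⇔ v ~ w) →
              sum (map (length ∘ adj) (allFin n)) ≤ 2 * ∣E∣ G
  handshake adj uniq adj⇔ = begin
    sum (map (length ∘ adj) (allFin n))
      ≤⟨ sum-map-mono (λ v → unique-⊆-length (uniq v) λ {w} w∈ →
           ∈-filter⁺ (v ~?_) (∈-allFin w) (Equivalence.to (adj⇔ v w) w∈)) (allFin n) ⟩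
    sum (map (λ v → length (filter (v ~?_) (allFin n))) (allFin n))
      ≡⟨ length-filter-cartesianProduct arc? (allFin n) (allFin n) ⟨
    length arcs
      ≤⟨ unique-⊆-length (Unique.filter⁺ arc? (Unique.cartesianProduct⁺ (Unique.allFin⁺ n) (Unique.allFin⁺ n))) orient ⟩
    length (edges ++ map swap edges)
      ≡⟨ length-++ edges ⟩
    length edges + length (map swap edges)
      ≡⟨ cong (length edges +_) (trans (length-map swap edges) (sym (+-identityʳ _))) ⟩
    2 * ∣E∣ G ∎
    where
    open ≤-Reasoning
    arc? : Decidable {A = Fin n × Fin n} λ p → proj₁ p ~ proj₂ p
    arc? p = proj₁ p ~? proj₂ p
    pairs = cartesianProduct (allFin n) (allFin n)
    arcs = filter arc? pairs
    edge? : Decidable {A = Fin n × Fin n} λ p → proj₁ p Fin.< proj₂ p × proj₁ p ~ proj₂ p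
    edge? p = (proj₁ p Fin.<? proj₂ p) ×-dec (proj₁ p ~? proj₂ p)
    edges = filter edge? pairs
    orient : ∀ {p} → p List.∈ arcs → p List.∈ edges ++ map swap edges
    orient {u , v} p∈ with Fin.<-cmp u v | proj₂ (∈-filter⁻ arc? {xs = pairs} p∈)
    ... | tri< u<v _ _  | u~v = ∈-++⁺ˡ (∈-filter⁺ edge? (∈-cartesianProduct⁺ (∈-allFin u) (∈-allFin v)) (u<v , u~v))
    ... | tri≈ _ refl _ | u~v = ⊥-elim (~-irrefl u~v)
    ... | tri> _ _ v<u  | u~v = ∈-++⁺ʳ edges (∈-map⁺ swap
            (∈-filter⁺ edge? (∈-cartesianProduct⁺ (∈-allFin v) (∈-allFin u)) (v<u , ~-sym u~v)))

-- Subsets as lists, independence numbers and balls.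

elements : ∀ {n} → Subset n → List (Fin n)
elements Vec.[]              = []
elements (inside  Vec.∷ S)   = zero ∷ map suc (elements S)
elements (outside Vec.∷ S)   = map suc (elements S)

length-elements : ∀ {n} (S : Subset n) → length (elements S) ≡ card S
length-elements Vec.[]            = refl
length-elements (inside  Vec.∷ S) = cong suc (trans (length-map suc (elements S)) (length-elements S))
length-elements (outside Vec.∷ S) = trans (length-map suc (elements S)) (length-elements S)

∈-elements⁺ : ∀ {n} {S : Subset n} {v} → v ∈ S → v List.∈ elements S
∈-elements⁺ {S = inside  Vec.∷ S} Vec.here        = here refl
∈-elements⁺ {S = inside  Vec.∷ S} (Vec.there v∈S) = there (∈-map⁺ suc (∈-elements⁺ v∈S))
∈-elements⁺ {S = outside Vec.∷ S} (Vec.there v∈S) = ∈-map⁺ suc (∈-elements⁺ v∈S)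

∈-elements⁻ : ∀ {n} {S : Subset n} {v} → v List.∈ elements S → v ∈ S
∈-elements⁻ {S = inside  Vec.∷ S} (here refl) = Vec.here
∈-elements⁻ {S = inside  Vec.∷ S} (there p) with _ , w∈ , refl ← ∈-map⁻ suc p = Vec.there (∈-elements⁻ w∈)
∈-elements⁻ {S = outside Vec.∷ S} p         with _ , w∈ , refl ← ∈-map⁻ suc p = Vec.there (∈-elements⁻ w∈)

elements-unique : ∀ {n} (S : Subset n) → Unique (elements S)
elements-unique Vec.[]            = []
elements-unique (inside  Vec.∷ S) =
  All.map⁺ (All.tabulate λ _ ()) ∷ Unique.map⁺ Fin.suc-injective (elements-unique S)
elements-unique (outside Vec.∷ S) = Unique.map⁺ Fin.suc-injective (elements-unique S)

α-≤ : ∀ {n} (G : Graph n) S ℓ → (∀ I → I ⊆ S → Independent G I → card I ≤ ℓ) → α G S ≤ ℓ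
α-≤ {n} G S ℓ bound = max≤v⁺ z≤n (All.map⁺ (All.tabulate λ {I} I∈ →
  let I⊆S , indep = proj₂ (∈-filter⁻ P? {xs = subsets n} I∈) in bound I I⊆S indep))
  where
  P? : Decidable λ I → I ⊆ S × Independent G I
  P? I = (I ⊆? S) ×-dec independent? G I

⟪_⟫ : ∀ {n} {P : Pred (Fin n) 0ℓ} → Decidable P → Subset n
⟪ P? ⟫ = Vec.tabulate (does ∘ P?)

module _ {n} {P : Pred (Fin n) 0ℓ} (P? : Decidable P) where

  ∈⟪⟫⁺ : ∀ {v} → P v → v ∈ ⟪ P? ⟫
  ∈⟪⟫⁺ {v} Pv = lookup⇒[]= v _ (trans (lookup∘tabulate (does ∘ P?) v) (dec-true (P? v) Pv))

  ∈⟪⟫⁻ : ∀ {v} → v ∈ ⟪ P? ⟫ → P v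
  ∈⟪⟫⁻ {v} v∈ with P? v | trans (sym (lookup∘tabulate (does ∘ P?) v)) ([]=⇒lookup v∈)
  ... | yes Pv | _  = Pv
  ... | no _   | ()

module _ {n : ℕ} (G : Graph n) where
  open Graph G

  Ball : ℕ → Subset n → Pred (Fin n) 0ℓ
  Ball r S v = ∃[ x ] (x ∈ S × DistAtMost G r x v)

  ball? : ∀ r S → Decidable (Ball r S)
  ball? r S v = Fin.any? λ x → (x ∈? S) ×-dec distAtMost? G r x v

  DistAtMost-sym : ∀ {d} → Symmetric (DistAtMost G d)
  DistAtMost-sym (l , l≤d , p) = l , l≤d , walk-sym G l p

  walk-++ : ∀ l {l′ u v w} → Walk G l u v → Walk G l′ v w → Walk G (l + l′) u w
  walk-++ zero    refl          q = q
  walk-++ (suc l) (x , u~x , p) q = x , u~x , walk-++ l p q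

  -- The first `a` edges are walked off. Either the walk ends by then, or its next edge is the one
  -- returned and at most `b` edges remain.
  walk-split : ∀ a b l {u v} → l ≤ a + suc b → Walk G l u v →
               DistAtMost G a u v ⊎ ∃[ x ] ∃[ y ] (DistAtMost G a u x × x ~ y × DistAtMost G b y v)
  walk-split a       b zero    _          refl          = inj₁ (0 , z≤n , refl)
  walk-split zero    b (suc l) (s≤s l≤b)  (w , u~w , p) = inj₂ (_ , w , (0 , z≤n , refl) , u~w , l , l≤b , p)
  walk-split (suc a) b (suc l) (s≤s l≤ab) (w , u~w , p) with walk-split a b l l≤ab p
  ... | inj₁ (m , m≤a , q)                       = inj₁ (suc m , s≤s m≤a , w , u~w , q)
  ... | inj₂ (x , y , (m , m≤a , q) , x~y , rest) =
    inj₂ (x , y , (suc m , s≤s m≤a , w , u~w , q) , x~y , rest)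

-- Arithmetic of the radius and of the number of layers.

div≡/ : ∀ m d .{{_ : NonZero d}} → div m d ≡ m / d
div≡/ m (suc d) = refl

d≤2⌊d/2⌋+1 : ∀ d → d ≤ d / 2 + suc (d / 2)
d≤2⌊d/2⌋+1 d = begin
  d                      ≡⟨ m≡m%n+[m/n]*n d 2 ⟩
  d % 2 + d / 2 * 2      ≤⟨ +-monoˡ-≤ _ (≤-pred (m%n<n d 2)) ⟩
  suc (d / 2 * 2)        ≡⟨ cong suc (*-comm (d / 2) 2) ⟩
  suc (d / 2 + (d / 2 + 0)) ≡⟨ cong (λ x → suc (d / 2 + x)) (+-identityʳ _) ⟩
  suc (d / 2 + d / 2)    ≡⟨ +-suc (d / 2) (d / 2) ⟨
  d / 2 + suc (d / 2)    ∎
  where open ≤-Reasoning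

⌊d/2⌋+⌊d/2⌋≤d : ∀ d → d / 2 + d / 2 ≤ d
⌊d/2⌋+⌊d/2⌋≤d d = begin
  d / 2 + d / 2        ≡⟨ cong (d / 2 +_) (+-identityʳ _) ⟨
  2 * (d / 2)          ≡⟨ *-comm 2 (d / 2) ⟩
  d / 2 * 2            ≤⟨ m/n*n≤m d 2 ⟩
  d                    ∎
  where open ≤-Reasoning

width-even : ∀ {d} → 2 ∣ d → d + (d / 2 + d / 2) ≡ 2 * d
width-even {d} 2∣d = cong (d +_) (begin
  d / 2 + d / 2        ≡⟨ cong (d / 2 +_) (+-identityʳ _) ⟨
  2 * (d / 2)          ≡⟨ *-comm 2 (d / 2) ⟩
  d / 2 * 2            ≡⟨ m/n*n≡m 2∣d ⟩
  d                    ≡⟨ +-identityʳ d ⟨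
  d + 0                ∎)
  where open ≡-Reasoning

width-odd : ∀ {d} → 2 ∤ d → d + (d / 2 + d / 2) ≡ 2 * d ∸ 1
width-odd {d} 2∤d = begin
  d + (d / 2 + d / 2)         ≡⟨ cong (_∸ 1) (+-suc d _) ⟨
  d + suc (d / 2 + d / 2) ∸ 1 ≡⟨ cong (λ x → d + x ∸ 1) odd ⟨
  d + d ∸ 1                   ≡⟨ cong (λ x → d + x ∸ 1) (+-identityʳ d) ⟨
  2 * d ∸ 1                   ∎
  where
  open ≡-Reasoning
  remainder : d % 2 ≡ 1
  remainder with d % 2 in eq | m%n<n d 2
  ... | 0 | _ = ⊥-elim (2∤d (m%n≡0⇒n∣m d 2 eq))
  ... | 1 | _ = refl
  ... | suc (suc _) | s≤s (s≤s ())
  odd : d ≡ suc (d / 2 + d / 2)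
  odd = begin
    d                       ≡⟨ m≡m%n+[m/n]*n d 2 ⟩
    d % 2 + d / 2 * 2       ≡⟨ cong₂ _+_ remainder (*-comm (d / 2) 2) ⟩
    suc (2 * (d / 2))       ≡⟨ cong (λ x → suc (d / 2 + x)) (+-identityʳ _) ⟩
    suc (d / 2 + d / 2)     ∎

∣m-n∣≤ : ∀ {m n k} → m ≤ n + k → n ≤ m + k → ∣ m - n ∣ ≤ k
∣m-n∣≤ {m} {n} {k} m≤n+k n≤m+k with ∣m-n∣≡[m∸n]∨[n∸m] m n
... | inj₁ eq rewrite eq = m≤n+o⇒m∸n≤o m n m≤n+k
... | inj₂ eq rewrite eq = m≤n+o⇒m∸n≤o n m n≤m+k

-- The tree decomposition and the layering of the power graph.

module PowerDecomposition {n : ℕ} {G : Graph n} (d : ℕ) .{{_ : NonZero d}}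
                          (𝒯 : TreeDecomposition G) (ℒ : Layering G) where
  open Graph G
  open TreeDecomposition 𝒯
  open Layering ℒ

  r : ℕ
  r = d / 2

  InBag : Fin size → Pred (Fin n) 0ℓ
  InBag t = Ball G r (bag t)

  bagᵈ : Fin size → Subset n
  bagᵈ t = ⟪ ball? G r (bag t) ⟫

  ∈bagᵈ⁺ : ∀ {t v} → InBag t v → v ∈ bagᵈ t
  ∈bagᵈ⁺ {t} = ∈⟪⟫⁺ (ball? G r (bag t))

  ∈bagᵈ⁻ : ∀ {t v} → v ∈ bagᵈ t → InBag t v
  ∈bagᵈ⁻ {t} = ∈⟪⟫⁻ (ball? G r (bag t))

  -- The walk is followed from `x` towards `u`. Each of its vertices is within `r` of `u`, so the
  -- nodes whose old bag holds that vertex form a connected set on which the new bags hold `u`; for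
  -- consecutive vertices these sets meet in a bag covering their edge. The node `t`, with `u` in
  -- its old bag, is the common meeting point of all such paths.
  pathToCentre : ∀ l {x u s t} → l ≤ r → Walk G l x u → x ∈ bag s → u ∈ bag t →
                 Star (λ a b → Graph._~_ tree a b × u ∈ bagᵈ a × u ∈ bagᵈ b) s t
  pathToCentre zero    l≤r refl x∈s u∈t =
    Star.map (λ (a~b , p , q) → a~b , centre p , centre q) (connected _ x∈s u∈t)
    where
    centre : ∀ {a u} → u ∈ bag a → u ∈ bagᵈ a
    centre u∈a = ∈bagᵈ⁺ (_ , u∈a , 0 , z≤n , refl)
  pathToCentre (suc l) {x} {u} l≤r (w , x~w , p) x∈s u∈t with t₀ , x∈t₀ , w∈t₀ ← edgeCovered x~w =
    Star.map (λ (a~b , p , q) → a~b , near p , near q) (connected _ x∈s x∈t₀)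
    ◅◅ pathToCentre l (≤-trans (n≤1+n l) l≤r) p w∈t₀ u∈t
    where
    near : ∀ {a} → x ∈ bag a → u ∈ bagᵈ a
    near x∈a = ∈bagᵈ⁺ (_ , x∈a , suc l , l≤r , w , x~w , p)

  𝒯ᵈ : TreeDecomposition (power G d)
  𝒯ᵈ = record
    { size          = size
    ; tree          = tree
    ; isTree        = isTree
    ; bag           = bagᵈ
    ; vertexCovered = λ v → let t , v∈t = vertexCovered v in t , ∈bagᵈ⁺ (v , v∈t , 0 , z≤n , refl)
    ; edgeCovered   = edgeCoveredᵈ
    ; connected     = connectedᵈ
    }
    where
    edgeCoveredᵈ : ∀ {u v} → Graph._~_ (power G d) u v → ∃[ t ] (u ∈ bagᵈ t × v ∈ bagᵈ t)
    edgeCoveredᵈ {u} {v} (_ , l , l≤d , p) with walk-split G r r l (≤-trans l≤d (d≤2⌊d/2⌋+1 d)) p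
    ... | inj₁ u→v with t , v∈t ← vertexCovered v =
      t , ∈bagᵈ⁺ (v , v∈t , DistAtMost-sym G u→v) , ∈bagᵈ⁺ (v , v∈t , 0 , z≤n , refl)
    ... | inj₂ (x , y , u→x , x~y , y→v) with t , x∈t , y∈t ← edgeCovered x~y =
      t , ∈bagᵈ⁺ (x , x∈t , DistAtMost-sym G u→x) , ∈bagᵈ⁺ (y , y∈t , y→v)

    connectedᵈ : ∀ u → ConnectedOn tree (λ t → u ∈ bagᵈ t)
    connectedᵈ u us ut
      with x , x∈s , l , l≤r , p ← ∈bagᵈ⁻ us
         | y , y∈t , m , m≤r , q ← ∈bagᵈ⁻ ut
         | t₀ , u∈t₀ ← vertexCovered u =
      pathToCentre l l≤r p x∈s u∈t₀
      ◅◅ Star.reverse (λ (a~b , p , q) → Graph.~-sym tree a~b , q , p) (pathToCentre m m≤r q y∈t u∈t₀)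

  layerOf : Fin n → ℕ
  layerOf v = proj₁ (covering v)

  -- One-sided, since the reversed walk yields the other inequality.
  layerOf-walk : ∀ l {u v} → Walk G l u v → layerOf u ≤ layerOf v + l
  layerOf-walk zero    refl = m≤m+n _ 0
  layerOf-walk (suc l) {u} {v} (w , u~w , p) = begin
    layerOf u              ≤⟨ m≤n+∣m-n∣ (layerOf u) (layerOf w) ⟩
    layerOf w + _          ≤⟨ +-monoʳ-≤ (layerOf w) (edgeSpan u~w (proj₂ (covering u)) (proj₂ (covering w))) ⟩
    layerOf w + 1          ≤⟨ +-monoˡ-≤ 1 (layerOf-walk l p) ⟩
    layerOf v + l + 1      ≡⟨ +-assoc (layerOf v) l 1 ⟩
    layerOf v + (l + 1)    ≡⟨ cong (layerOf v +_) (+-comm l 1) ⟩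
    layerOf v + suc l      ∎
    where open ≤-Reasoning

  -- `div` instead of `_/_`, because the machine evaluates exactly this expression, so the stored
  -- layers agree without conversion.
  layer? : ∀ i → Decidable (λ v → div (layerOf v) d ≡ i)
  layer? i v = div (layerOf v) d ≟ i

  partᵈ : ℕ → Subset n
  partᵈ i = ⟪ layer? i ⟫

  -- The walk raises the layer by at most `d`, and adding `d` raises the quotient by exactly 1.
  div-layerOf-walk : ∀ l {u v} → l ≤ d → Walk G l u v → div (layerOf u) d ≤ div (layerOf v) d + 1
  div-layerOf-walk l {u} {v} l≤d p = begin
    div (layerOf u) d           ≡⟨ div≡/ (layerOf u) d ⟩
    layerOf u / d               ≤⟨ /-monoˡ-≤ d (≤-trans (layerOf-walk l p) (+-monoʳ-≤ _ l≤d)) ⟩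
    (layerOf v + d) / d         ≡⟨ +-distrib-/-∣ʳ (layerOf v) ∣-refl ⟩
    layerOf v / d + d / d       ≡⟨ cong (layerOf v / d +_) (n/n≡1 d) ⟩
    layerOf v / d + 1           ≡⟨ cong (_+ 1) (div≡/ (layerOf v) d) ⟨
    div (layerOf v) d + 1       ∎
    where open ≤-Reasoning

  ℒᵈ : Layering (power G d)
  ℒᵈ = record
    { part     = partᵈ
    ; covering = λ v → _ , ∈⟪⟫⁺ (layer? _) refl
    ; disjoint = λ {v} {i} {j} p q → trans (sym (∈⟪⟫⁻ (layer? i) p)) (∈⟪⟫⁻ (layer? j) q)
    ; edgeSpan = λ {u} {v} {i} {j} (_ , l , l≤d , p) u∈i v∈j →
        subst₂ (λ a b → ∣ a - b ∣ ≤ 1) (∈⟪⟫⁻ (layer? i) u∈i) (∈⟪⟫⁻ (layer? j) v∈j)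
          (∣m-n∣≤ (div-layerOf-walk l l≤d p) (div-layerOf-walk l l≤d (walk-sym G l p)))
    }

  module _ {k : ℕ} (width : WitnessLayeredTreewidth 𝒯 ℒ k) where

    -- A vertex of layer a at distance at most r from one of layer b with b / d = j
    -- satisfies j * d ≤ a + r < j * d + (d + 2r), so a = j * d + i ∸ r without truncation.
    nearby : Fin size → ℕ → ℕ → List (Fin n)
    nearby t j w = concat (map (λ i → elements (bag t ∩ part (j * d + i ∸ r))) (upTo w))

    -- Arbitrary indices in place of `upTo` make the induction possible. When `j` is 0, truncation
    -- can let several indices name layer 0; such repetitions are harmless in an upper bound.
    length-nearby : ∀ t (f : ℕ → ℕ) is →
                    length (concat (map (λ i → elements (bag t ∩ part (f i))) is)) ≤ length is * k
    length-nearby t f []       = z≤n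
    length-nearby t f (i ∷ is) = begin
      length (elements (bag t ∩ part (f i)) ++ _)          ≡⟨ length-++ (elements (bag t ∩ part (f i))) ⟩
      length (elements (bag t ∩ part (f i))) + _           ≤⟨ +-mono-≤ (≤-reflexive (length-elements (bag t ∩ part (f i)))) (length-nearby t f is) ⟩
      card (bag t ∩ part (f i)) + length is * k ≤⟨ +-monoˡ-≤ _ (width t (f i)) ⟩
      k + length is * k                                    ∎
      where open ≤-Reasoning

    treeIndependence : WitnessLayeredTreeIndependence 𝒯ᵈ ℒᵈ ((d + (r + r)) * k)
    treeIndependence t j = α-≤ (power G d) _ _ λ I I⊆ indep → begin
      card I     ≡⟨ length-elements I ⟨
      length (elements I)       ≤⟨ length-≤ (λ v x → DistAtMost G r x v) (elements-unique I)
                                     (λ v∈ → centre I I⊆ (∈-elements⁻ v∈))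
                                     (λ p q → together I indep (∈-elements⁻ p) (∈-elements⁻ q)) ⟩
      length (nearby t j (d + (r + r)))   ≤⟨ length-nearby t (λ i → j * d + i ∸ r) (upTo (d + (r + r))) ⟩
      length (upTo (d + (r + r))) * k     ≡⟨ cong (_* k) (length-upTo (d + (r + r))) ⟩
      (d + (r + r)) * k         ∎
      where
      open ≤-Reasoning
      together : ∀ I → Independent (power G d) I → ∀ {u v x} → u ∈ I → v ∈ I →
                 DistAtMost G r x u → DistAtMost G r x v → u ≡ v
      together I indep {u} {v} u∈I v∈I (l , l≤r , p) (m , m≤r , q) with u Fin.≟ v
      ... | yes u≡v = u≡v
      ... | no  u≢v = ⊥-elim (indep u v u∈I v∈I (u≢v , l + m ,
              ≤-trans (+-mono-≤ l≤r m≤r) (⌊d/2⌋+⌊d/2⌋≤d d) , walk-++ G l (walk-sym G l p) q))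

      centre : ∀ I → I ⊆ bagᵈ t ∩ partᵈ j → ∀ {v} → v ∈ I →
               ∃[ x ] (x List.∈ nearby t j (d + (r + r)) × DistAtMost G r x v)
      centre I I⊆ {v} v∈I
        with v∈bag , v∈part ← x∈p∩q⁻ (bagᵈ t) (partᵈ j) (I⊆ v∈I)
        with x , x∈t , l , l≤r , p ← ∈bagᵈ⁻ v∈bag =
        x , ∈-concat⁺′ (∈-elements⁺ (x∈p∩q⁺ (x∈t , x∈layer))) (∈-map⁺ _ (∈-upTo⁺ i<)) , l , l≤r , p
        where
        a b i : ℕ
        a = layerOf x
        b = layerOf v
        i = a + r ∸ j * d
        quotient : b / d ≡ j
        quotient = trans (sym (div≡/ b d)) (∈⟪⟫⁻ (layer? j) v∈part)
        jd≤b : j * d ≤ b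
        jd≤b = subst (λ q → q * d ≤ b) quotient (m/n*n≤m b d)
        b< : suc b ≤ j * d + d
        b< = begin
          suc b                      ≡⟨ cong suc (m≡m%n+[m/n]*n b d) ⟩
          suc (b % d) + b / d * d    ≤⟨ +-monoˡ-≤ _ (m%n<n b d) ⟩
          d + b / d * d              ≡⟨ cong (λ q → d + q * d) quotient ⟩
          d + j * d                  ≡⟨ +-comm d _ ⟩
          j * d + d                  ∎
        b≤a+r : b ≤ a + r
        b≤a+r = ≤-trans (layerOf-walk l (walk-sym G l p)) (+-monoʳ-≤ a l≤r)
        jd+i : j * d + i ≡ a + r
        jd+i = m+[n∸m]≡n (≤-trans jd≤b b≤a+r)
        x∈layer : x ∈ part (j * d + i ∸ r)
        x∈layer = subst (λ c → x ∈ part c) (sym (trans (cong (_∸ r) jd+i) (m+n∸n≡m a r))) (proj₂ (covering x))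
        i< : i < d + (r + r)
        i< = +-cancelˡ-< (j * d) i _ (begin-strict
          j * d + i              ≡⟨ jd+i ⟩
          a + r                  ≤⟨ +-monoˡ-≤ r (≤-trans (layerOf-walk l p) (+-monoʳ-≤ b l≤r)) ⟩
          b + r + r              ≡⟨ +-assoc b r r ⟩
          b + (r + r)            <⟨ +-monoˡ-< (r + r) b< ⟩
          j * d + d + (r + r)    ≡⟨ +-assoc (j * d) d _ ⟩
          j * d + (d + (r + r))  ∎)

-- A program logic with costs and frames.

-- Total correctness from one start state, with the final state and the exact time hidden behind `Q`
-- and `b`.
record Exec (c : Cmd) (σ : State) (Q : State → Set) (b : ℕ) : Set where
  constructor exec
  field
    {final} : State
    {steps} : ℕ
    run     : Run c σ final steps
    bound   : steps ≤ b
    post    : Q final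

module _ {Q : State → Set} where

  exec-skip : ∀ {σ} → Q σ → Exec skip σ Q 1
  exec-skip q = exec run-skip ≤-refl q

  exec-assign : ∀ {x e σ} → Q (setVar σ x (⟦ e ⟧ σ)) → Exec (x ≔ e) σ Q (suc (cost e))
  exec-assign q = exec run-var ≤-refl q

  exec-store : ∀ {a e f σ} → Q (setArr σ a (⟦ e ⟧ σ) (⟦ f ⟧ σ)) →
               Exec (a [ e ]≔ f) σ Q (suc (cost e + cost f))
  exec-store q = exec run-arr ≤-refl q

  -- The continuation sits in the postcondition of `c₁`, so no intermediate assertion has to be
  -- written. Its bound `b₂` cannot depend on `ρ`: a cost that depends on the state reached must be
  -- bounded uniformly first.
  exec-seq : ∀ {c₁ c₂ σ b₁ b₂} → Exec c₁ σ (λ ρ → Exec c₂ ρ Q b₂) b₁ → Exec (c₁ ⨾ c₂) σ Q (b₁ + b₂)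
  exec-seq (exec r₁ s₁≤ (exec r₂ s₂≤ q)) = exec (run-seq r₁ r₂) (+-mono-≤ s₁≤ s₂≤) q

  exec-then : ∀ {e c₁ c₂ σ b} → ⟦ e ⟧ σ ≢ 0 → Exec c₁ σ Q b → Exec (if e c₁ c₂) σ Q (suc (cost e + b))
  exec-then {e} e≢0 (exec r s≤ q) = exec (run-then e≢0 r) (s≤s (+-monoʳ-≤ (cost e) s≤)) q

  exec-else : ∀ {e c₁ c₂ σ b} → ⟦ e ⟧ σ ≡ 0 → Exec c₂ σ Q b → Exec (if e c₁ c₂) σ Q (suc (cost e + b))
  exec-else {e} e≡0 (exec r s≤ q) = exec (run-else e≡0 r) (s≤s (+-monoʳ-≤ (cost e) s≤)) q

  exec-done : ∀ {e c σ} → ⟦ e ⟧ σ ≡ 0 → Q σ → Exec (while e c) σ Q (suc (cost e))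
  exec-done e≡0 q = exec (run-done e≡0) ≤-refl q

  exec-repeat : ∀ {e c σ b₁ b₂} → ⟦ e ⟧ σ ≢ 0 → Exec c σ (λ ρ → Exec (while e c) ρ Q b₂) b₁ →
                Exec (while e c) σ Q (suc (cost e + (b₁ + b₂)))
  exec-repeat {e} e≢0 (exec r₁ s₁≤ (exec r₂ s₂≤ q)) =
    exec (run-repeat e≢0 r₁ r₂) (s≤s (+-monoʳ-≤ (cost e) (+-mono-≤ s₁≤ s₂≤))) q

  exec-within : ∀ {c σ b b′} → b ≤ b′ → Exec c σ Q b → Exec c σ Q b′
  exec-within b≤b′ (exec r s≤ q) = exec r (≤-trans s≤ b≤b′) q

exec-map : ∀ {P Q : State → Set} {c σ b} → (∀ {τ} → P τ → Q τ) → Exec c σ P b → Exec c σ Q b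
exec-map f (exec r s≤ p) = exec r s≤ (f p)

module _ {A : Set} (f : ℕ → A) where

  update-same : ∀ i x → update f i x i ≡ x
  update-same i x with i ≡ᵇ i in eq
  ... | true  = refl
  ... | false with () ← subst T eq (≡⇒≡ᵇ i i refl)

  update-other : ∀ {i j} x → j ≢ i → update f i x j ≡ f j
  update-other {i} {j} x j≢i with j ≡ᵇ i in eq
  ... | true  = ⊥-elim (j≢i (≡ᵇ⇒≡ j i (subst T (sym eq) tt)))
  ... | false = refl

-- The masks list what is preserved rather than what is written, so frames compose by transitivity
-- and weaken by `frame-⊆`. Preserved arrays are equal as functions and can be substituted whole.
record Frame (A V : ℕ → Bool) (σ τ : State) : Set where
  constructor frame
  field
    arrays    : ∀ a → A a ≡ true → arr τ a ≡ arr σ a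
    variables : ∀ x → V x ≡ true → var τ x ≡ var σ x

open Frame

separates : ∀ (B : ℕ → Bool) {x y} → B y ≡ false → B x ≡ true → x ≢ y
separates B By Bx refl with () ← trans (sym Bx) By

module _ {A V : ℕ → Bool} where

  frame-refl : ∀ {σ} → Frame A V σ σ
  frame-refl = frame (λ _ _ → refl) (λ _ _ → refl)

  frame-trans : ∀ {σ ρ τ} → Frame A V σ ρ → Frame A V ρ τ → Frame A V σ τ
  frame-trans p q = frame (λ a Aa → trans (arrays q a Aa) (arrays p a Aa))
                          (λ x Vx → trans (variables q x Vx) (variables p x Vx))

  frame-setVar : ∀ {σ ρ} x {v} → V x ≡ false → Frame A V σ ρ → Frame A V σ (setVar ρ x v)
  frame-setVar {ρ = ρ} x Vx p = frame (arrays p) λ y Vy →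
    trans (update-other (var ρ) _ (separates V Vx Vy)) (variables p y Vy)

  frame-setArr : ∀ {σ ρ} a {i v} → A a ≡ false → Frame A V σ ρ → Frame A V σ (setArr ρ a i v)
  frame-setArr {ρ = ρ} a Aa p = frame (λ b Ab → trans (update-other (arr ρ) _ (separates A Aa Ab)) (arrays p b Ab)) (variables p)

frame-⊆ : ∀ {A A′ V V′ σ τ} → (∀ a → A′ a ≡ true → A a ≡ true) → (∀ x → V′ x ≡ true → V x ≡ true) →
          Frame A V σ τ → Frame A′ V′ σ τ
frame-⊆ A′⊆A V′⊆V p = frame (λ a → arrays p a ∘ A′⊆A a) (λ x → variables p x ∘ V′⊆V x)

-- Variables are numbered so that inner commands only change larger numbers, which
-- makes their frames initial segments; membership of a literal then holds by refl.
below : ℕ → ℕ → Bool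
below q x = x <ᵇ q

below-⊆ : ∀ {p q} → p ≤ q → ∀ x → below p x ≡ true → below q x ≡ true
below-⊆ {p} {q} p≤q x x<p with x <ᵇ q in eq
... | true  = refl
... | false = ⊥-elim (subst T eq (<⇒<ᵇ (≤-trans (<ᵇ⇒< x p (subst T (sym x<p) tt)) p≤q)))

index : Var
index = 10

except : ℕ → ℕ → Bool
except x y = not (y ≡ᵇ x)

below-⊆-except : ∀ {q x} → q ≤ x → ∀ y → below q y ≡ true → except x y ≡ true
below-⊆-except {q} {x} q≤x y y<q with y ≡ᵇ x in eq
... | false = refl
... | true  = ⊥-elim (<⇒≱ (<ᵇ⇒< y q (subst T (sym y<q) tt))
                          (subst (q ≤_) (sym (≡ᵇ⇒≡ y x (subst T (sym eq) tt))) q≤x))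

except-self : ∀ x → except x x ≡ false
except-self x with x ≡ᵇ x in eq
... | true  = refl
... | false with () ← subst T eq (≡⇒≡ᵇ x x refl)

fill : Arr → Expr → Expr → Cmd
fill a e n = index ≔ lit 0 ⨾ while (n ⊖ reg index) (a [ reg index ]≔ e ⨾ index ≔ inc (reg index))

FillFrame : Arr → State → State → Set
FillFrame a = Frame (except a) (except index)

fillRound : Expr → Expr → ℕ
fillRound e n = suc (cost (n ⊖ reg index)) + (suc (1 + cost e) + 3)

-- `n` and `e` need the right value only in states that a partial fill can reach. The last premise
-- of `e≡g`, that cell `j` is still old, admits an expression reading the cell it overwrites, as in
-- the in-place division of `layer`.
module _ (a : Arr) (e n : Expr) (σ : State) (N : ℕ) (g : ℕ → ℕ)
         (n≡N : ∀ {ρ} → FillFrame a σ ρ → ⟦ n ⟧ ρ ≡ N)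
         (e≡g : ∀ {ρ} j → j < N → FillFrame a σ ρ → var ρ index ≡ j → arr ρ a j ≡ arr σ a j → ⟦ e ⟧ ρ ≡ g j)
         where

  fill-loop : ∀ k j ρ → j + k ≡ N → FillFrame a σ ρ → var ρ index ≡ j →
              (∀ i → i < j → arr ρ a i ≡ g i) → (∀ i → j ≤ i → arr ρ a i ≡ arr σ a i) →
              Exec (while (n ⊖ reg index) (a [ reg index ]≔ e ⨾ index ≔ inc (reg index))) ρ
                   (λ τ → FillFrame a σ τ × (∀ i → i < N → arr τ a i ≡ g i))
                   (k * fillRound e n + suc (cost (n ⊖ reg index)))
  fill-loop zero    j ρ j+0≡N fr refl filled rest =
    exec-done (trans (cong (_∸ j) (trans (n≡N fr) (trans (sym j+0≡N) (+-identityʳ j)))) (n∸n≡0 j))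
              (fr , λ i i<N → filled i (subst (i <_) (trans (sym j+0≡N) (+-identityʳ j)) i<N))
  fill-loop (suc k) j ρ refl fr refl filled rest =
    exec-within (≤-reflexive (arith (cost (n ⊖ reg index)) (suc (1 + cost e) + 3) (k * fillRound e n)))
    (exec-repeat (λ eq → 1+n≢0 (trans (sym (m+n∸m≡n j (suc k))) (trans (sym (cong (_∸ j) (n≡N fr))) eq)))
    (exec-seq (exec-store (exec-assign
      (fill-loop k (suc j) _ (sym (+-suc j k))
        (frame-setVar index refl (frame-setArr a (except-self a) fr))
        refl
        filled′ rest′)))))
    where
    arith : ∀ x y z → suc (x + (y + (z + suc x))) ≡ suc x + y + z + suc x
    arith = solve-∀
    new : ℕ → ℕ
    new = update (arr ρ) a (update (arr ρ a) j (⟦ e ⟧ ρ)) a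
    new≡ : new ≡ update (arr ρ a) j (⟦ e ⟧ ρ)
    new≡ = update-same (arr ρ) a _
    filled′ : ∀ i → i < suc j → new i ≡ g i
    filled′ i i<1+j with i ≟ j
    ... | yes refl = trans (cong-app new≡ j) (trans (update-same (arr ρ a) j _)
                       (e≡g j (m<m+n j (s≤s z≤n)) fr refl (rest j ≤-refl)))
    ... | no  i≢j  = trans (cong-app new≡ i) (trans (update-other (arr ρ a) _ i≢j)
                       (filled i (≤∧≢⇒< (≤-pred i<1+j) i≢j)))
    rest′ : ∀ i → suc j ≤ i → new i ≡ arr σ a i
    rest′ i j<i = trans (cong-app new≡ i) (trans (update-other (arr ρ a) _ (≢-sym (<⇒≢ j<i)))
                    (rest i (<⇒≤ j<i)))

  fill-spec : Exec (fill a e n) σ (λ τ → FillFrame a σ τ × (∀ i → i < N → arr τ a i ≡ g i))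
                   (2 + (N * fillRound e n + suc (cost (n ⊖ reg index))))
  fill-spec = exec-seq (exec-assign
    (fill-loop N 0 _ refl (frame-setVar index refl frame-refl) refl (λ _ ()) (λ _ _ → refl)))

-- Lists in arrays, and appending vertices to the search queue.

module _ {n : ℕ} where

  -- The element clause of `StoresSets` in recursive form: a loop reading one cell per round peels
  -- off one constructor.
  Segment : (ℕ → ℕ) → ℕ → List (Fin n) → Set
  Segment f k []       = ⊤
  Segment f k (x ∷ xs) = f k ≡ toℕ x × Segment f (suc k) xs

  segment-lookup⁻ : ∀ {f} k xs → (∀ j → f (k + toℕ j) ≡ toℕ (lookup xs j)) → Segment f k xs
  segment-lookup⁻ {f} k []       h = tt
  segment-lookup⁻ {f} k (x ∷ xs) h =
    trans (cong f (sym (+-identityʳ k))) (h zero) ,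
    segment-lookup⁻ (suc k) xs (λ j → trans (cong f (sym (+-suc k (toℕ j)))) (h (suc j)))

  segment-lookup⁺ : ∀ {f} k xs → Segment f k xs → ∀ j → f (k + toℕ j) ≡ toℕ (lookup xs j)
  segment-lookup⁺ {f} k (x ∷ xs) (fk , s) zero    = trans (cong f (+-identityʳ k)) fk
  segment-lookup⁺ {f} k (x ∷ xs) (fk , s) (suc j) = trans (cong f (+-suc k (toℕ j))) (segment-lookup⁺ (suc k) xs s j)

  segment-agree : ∀ {f g b} k xs → (∀ j → j < b → g j ≡ f j) → k + length xs ≤ b → Segment f k xs → Segment g k xs
  segment-agree k []       agree le s = tt
  segment-agree k (x ∷ xs) agree le (fk , s) =
    trans (agree k (≤-trans (m<m+n k (s≤s z≤n)) le)) fk ,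
    segment-agree (suc k) xs agree (≤-trans (≤-reflexive (sym (+-suc k (length xs)))) le) s

  segment-snoc : ∀ {f} k xs x → Segment f k xs → f (k + length xs) ≡ toℕ x → Segment f k (xs ++ x ∷ [])
  segment-snoc {f} k []       x s        fx = trans (cong f (sym (+-identityʳ k))) fx , tt
  segment-snoc {f} k (y ∷ xs) x (fk , s) fx =
    fk , segment-snoc (suc k) xs x s (trans (cong f (sym (+-suc k (length xs)))) fx)

  segment-++⁻ : ∀ {f} k xs {ys} → Segment f k (xs ++ ys) → Segment f (k + length xs) ys
  segment-++⁻ {f} k []       {ys} s       = subst (λ k → Segment f k ys) (sym (+-identityʳ k)) s
  segment-++⁻ {f} k (x ∷ xs) {ys} (_ , s) =
    subst (λ k → Segment f k ys) (sym (+-suc k (length xs))) (segment-++⁻ (suc k) xs s)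

radius node level stop head vertex tail end target : Var
radius = 3
node   = 4
level  = 5
stop   = 6
head   = 7
vertex = 8
tail   = 9
end    = 11
target = 12

newOffs newElts mark : Arr
newOffs = 7
newElts = 8
mark    = 9

-- mark [ v ] = t + 1 says that v is in the new bag of node t.  Stamps of earlier nodes
-- are smaller, so mark need not be cleared between searches.
push : Cmd
push = if (inc (reg node) ⊖ mark [ reg target ])
          (newElts [ reg tail ]≔ reg target ⨾ mark [ reg target ]≔ inc (reg node) ⨾ tail ≔ inc (reg tail))
          skip

scanLoop : Arr → Cmd
scanLoop elts = while (reg end ⊖ reg index)
                      (target ≔ elts [ reg index ] ⨾ index ≔ inc (reg index) ⨾ push)

-- Used twice: on an old bag, to seed the search, and on an adjacency list, to expand a vertex.
scan : Arr → Arr → Var → Cmd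
scan offs elts x = index ≔ offs [ reg x ] ⨾ end ≔ offs [ inc (reg x) ] ⨾ scanLoop elts

module _ {n : ℕ} where

  open import Data.List.Membership.DecPropositional (Fin._≟_ {n}) using () renaming (_∈?_ to _∈ₗ?_)

  -- The new bag, written to newElts from position base on, doubles as the queue of the search.
  record Queue (t base top : ℕ) (elts marks : ℕ → ℕ) (L : List (Fin n)) : Set where
    field
      top≡     : top ≡ base + length L
      stored   : Segment elts base L
      marked   : ∀ {v} → v List.∈ L → marks (toℕ v) ≡ suc t
      unmarked : ∀ {v} → ¬ v List.∈ L → marks (toℕ v) ≤ t
      unique   : Unique L

  open Queue

  QueueAt : State → ℕ → List (Fin n) → Set
  QueueAt σ base = Queue (var σ node) base (var σ tail) (arr σ newElts) (arr σ mark)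

  -- The effect of offering the set `S` to the queue. A vertex already queued is not pushed again,
  -- so `sound` speaks of `new` alone while `complete` also admits `L`. Keeping the cells below the
  -- old `tail` protects both the bags of earlier nodes and the queue entries still to be read.
  record Extends (V : ℕ → Bool) (base : ℕ) (L : List (Fin n)) (S : Pred (Fin n) 0ℓ) (σ τ : State) : Set where
    field
      framed   : Frame (below 8) V σ τ
      kept     : ∀ j → j < var σ tail → arr τ newElts j ≡ arr σ newElts j
      new      : List (Fin n)
      queue    : QueueAt τ base (L ++ new)
      sound    : ∀ {v} → v List.∈ new → S v
      complete : ∀ {v} → S v → v List.∈ L ++ new

  open Extends

  extends-tail : ∀ {V base L S σ τ} → QueueAt σ base L → Extends V base L S σ τ → var σ tail ≤ var τ tail
  extends-tail {base = base} {L} {σ = σ} {τ} Q E = begin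
    var σ tail                                ≡⟨ top≡ Q ⟩
    base + length L                           ≤⟨ +-monoʳ-≤ base (m≤m+n _ _) ⟩
    base + (length L + length (new E))        ≡⟨ cong (base +_) (length-++ L) ⟨
    base + length (L ++ new E)                ≡⟨ top≡ (queue E) ⟨
    var τ tail                                ∎
    where open ≤-Reasoning

  extends-trans : ∀ {V base L S₁ S₂ σ ρ τ} → QueueAt σ base L → (E : Extends V base L S₁ σ ρ) →
                  Extends V base (L ++ new E) S₂ ρ τ → Extends V base L (λ v → S₁ v ⊎ S₂ v) σ τ
  extends-trans {base = base} {L} {S₁} {S₂} {τ = τ} Q E F = record
    { framed   = frame-trans (framed E) (framed F)
    ; kept     = λ j j< → trans (kept F j (≤-trans j< (extends-tail Q E))) (kept E j j<)
    ; new      = new E ++ new F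
    ; queue    = subst (QueueAt τ base) assoc (queue F)
    ; sound    = sound′
    ; complete = λ { (inj₁ p) → subst (_ List.∈_) assoc (∈-++⁺ˡ (complete E p))
                   ; (inj₂ p) → subst (_ List.∈_) assoc (complete F p) }
    }
    where
    assoc : (L ++ new E) ++ new F ≡ L ++ (new E ++ new F)
    assoc = ++-assoc L (new E) (new F)
    sound′ : ∀ {v} → v List.∈ new E ++ new F → S₁ v ⊎ S₂ v
    sound′ v∈ with ∈-++⁻ (new E) v∈
    ... | inj₁ p = inj₁ (sound E p)
    ... | inj₂ p = inj₂ (sound F p)

  extends-⊆ : ∀ {V V′ base L S S′ σ τ} → (∀ x → V′ x ≡ true → V x ≡ true) →
              (∀ {v} → S v → S′ v) → (∀ {v} → S′ v → S v) →
              Extends V base L S σ τ → Extends V′ base L S′ σ τ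
  extends-⊆ V′⊆V to from E = record
    { framed = frame-⊆ (λ _ → id) V′⊆V (framed E) ; kept = kept E ; new = new E
    ; queue = queue E ; sound = to ∘ sound E ; complete = complete E ∘ from }

  extends-from : ∀ {V base L S σ ρ τ} → Frame (below 8) V σ ρ →
                 var ρ tail ≡ var σ tail → arr ρ newElts ≡ arr σ newElts →
                 Extends V base L S ρ τ → Extends V base L S σ τ
  extends-from fr tail≡ elts≡ E = record
    { framed = frame-trans fr (framed E)
    ; kept = λ j j< → trans (kept E j (subst (j <_) (sym tail≡) j<)) (cong-app elts≡ j)
    ; new = new E ; queue = queue E ; sound = sound E ; complete = complete E }

  unique-snoc : ∀ {L : List (Fin n)} {x} → Unique L → ¬ x List.∈ L → Unique (L ++ x ∷ [])
  unique-snoc uniq x∉L = Unique.++⁺ uniq ([] ∷ []) λ { (p , here refl) → x∉L p }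

  -- The stamp test decides membership in `L`: the difference vanishes for the current stamp and is
  -- positive for any smaller one. Pushing costs 16 units, skipping only 7.
  push-spec : ∀ σ base L x → var σ target ≡ toℕ x → QueueAt σ base L →
              Exec push σ (Extends (except tail) base L (_≡ x) σ) 16
  push-spec σ base L x target≡ Q with x ∈ₗ? L
  ... | yes x∈L = exec-within (m≤m+n 7 9) (exec-else
                    (trans (cong (suc (var σ node) ∸_) (trans (cong (arr σ mark) target≡) (marked Q x∈L))) (n∸n≡0 (suc (var σ node))))
                    (exec-skip (record
        { framed = frame-refl ; kept = λ _ _ → refl ; new = []
        ; queue = subst (QueueAt σ base) (sym (++-identityʳ L)) Q
        ; sound = λ ()
        ; complete = λ { refl → ∈-++⁺ˡ x∈L } })))
  ... | no  x∉L = exec-then (λ eq → n≮n _ (≤-trans (m∸n≡0⇒m≤n eq) (≤-trans (≤-reflexive (cong (arr σ mark) target≡)) (unmarked Q x∉L))))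
                    (exec-seq (exec-store (exec-seq (exec-store (exec-assign (record
        { framed = frame-setVar tail refl (frame-setArr mark refl (frame-setArr newElts refl frame-refl))
        ; kept = λ j j< → update-other (arr σ newElts) _ (<⇒≢ j<)
        ; new = x ∷ []
        ; queue = record
            { top≡     = begin
                suc (var σ tail)               ≡⟨ cong suc (top≡ Q) ⟩
                suc (base + length L)          ≡⟨ +-suc base _ ⟨
                base + suc (length L)          ≡⟨ cong (base +_) (+-comm 1 (length L)) ⟩
                base + (length L + 1)          ≡⟨ cong (base +_) (length-++ L) ⟨
                base + length (L ++ x ∷ [])    ∎
            ; stored   = segment-snoc base L x
                (segment-agree base L (λ j j< → update-other (arr σ newElts) _ (<⇒≢ j<)) (≤-reflexive (sym (top≡ Q))) (stored Q))
                (trans (cong (update (arr σ newElts) (var σ tail) (var σ target)) (sym (top≡ Q)))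
                       (trans (update-same (arr σ newElts) (var σ tail) _) target≡))
            ; marked   = marked′
            ; unmarked = λ {v} v∉ → ≤-trans (≤-reflexive (update-other (arr σ mark) _ λ eq →
                v∉ (∈-++⁺ʳ L (here (Fin.toℕ-injective (trans eq target≡))))))
                (unmarked Q (v∉ ∘ ∈-++⁺ˡ))
            ; unique   = unique-snoc (unique Q) x∉L
            }
        ; sound = λ { (here refl) → refl }
        ; complete = λ { refl → ∈-++⁺ʳ L (here refl) } }))))))
    where
    open ≡-Reasoning
    marked′ : ∀ {v} → v List.∈ L ++ x ∷ [] → update (arr σ mark) (var σ target) (suc (var σ node)) (toℕ v) ≡ suc (var σ node)
    marked′ {v} v∈ with v Fin.≟ x | ∈-++⁻ L v∈
    ... | yes refl | _                 = trans (cong (update (arr σ mark) (var σ target) (suc (var σ node))) (sym target≡))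
                                             (update-same (arr σ mark) (var σ target) _)
    ... | no  v≢x  | inj₁ v∈L          = trans (update-other (arr σ mark) _ λ eq → v≢x (Fin.toℕ-injective (trans eq target≡))) (marked Q v∈L)
    ... | no  v≢x  | inj₂ (here refl)  = ⊥-elim (v≢x refl)

  -- Each element costs 26 units: 4 for the test, 3 for each of the two assignments and 16 for
  -- `push`. The final 4 is the failing test.
  scanLoop-spec : ∀ elts → below 8 elts ≡ true → ∀ xs σ base L →
                  Segment (arr σ elts) (var σ index) xs → var σ end ≡ var σ index + length xs →
                  QueueAt σ base L →
                  Exec (scanLoop elts) σ (Extends (below 9) base L (List._∈ xs) σ) (length xs * 26 + 4)
  scanLoop-spec elts elts< [] σ base L s end≡ Q =
    exec-done (trans (cong (_∸ var σ index) (trans end≡ (+-identityʳ _))) (n∸n≡0 (var σ index))) (record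
      { framed = frame-refl ; kept = λ _ _ → refl ; new = []
      ; queue = subst (QueueAt σ base) (sym (++-identityʳ L)) Q ; sound = λ () ; complete = λ () })
  scanLoop-spec elts elts< (x ∷ xs) σ base L (sx , s) end≡ Q =
    exec-repeat (λ eq → 1+n≢0 (trans (sym (trans (cong (_∸ var σ index) end≡) (m+n∸m≡n (var σ index) _))) eq))
    (exec-seq (exec-assign (exec-seq (exec-assign
      (exec-map (λ {ρ} E →
        exec-map (λ F → extends-⊆ (λ _ → id) (λ { (inj₁ refl) → here refl ; (inj₂ p) → there p })
                                         (λ { (here refl) → inj₁ refl ; (there p) → inj₂ p })
                          (extends-trans Q (extends-from (frame-setVar index refl (frame-setVar target refl frame-refl)) refl refl
                                            (extends-⊆ (below-⊆-except ≤-refl) id id E)) F))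
        (scanLoop-spec elts elts< xs ρ base (L ++ new E)
          (subst₂ (λ f i → Segment f i xs) (sym (arrays (framed E) elts elts<))
            (sym (variables (framed E) index refl)) s)
          (trans (variables (framed E) end refl) (trans end≡ (trans (+-suc (var σ index) (length xs))
            (cong (_+ length xs) (sym (variables (framed E) index refl))))))
          (queue E)))
      (push-spec _ base L x sx Q))))))

open Queue
open Extends

scan-spec : ∀ {n} offs elts x → below 8 offs ≡ true → below 8 elts ≡ true → below 9 x ≡ true →
            ∀ (xs : List (Fin n)) σ base L → Segment (arr σ elts) (arr σ offs (var σ x)) xs →
            arr σ offs (suc (var σ x)) ≡ arr σ offs (var σ x) + length xs → QueueAt σ base L →
            Exec (scan offs elts x) σ (Extends (below 9) base L (List._∈ xs) σ) (length xs * 26 + 11)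
scan-spec offs elts x offs< elts< x< xs σ base L s end≡ Q =
  exec-within (≤-reflexive (arith (length xs)))
  (exec-seq (exec-assign (exec-seq (exec-assign (exec-map
    (extends-from (frame-setVar end refl (frame-setVar index refl frame-refl)) refl refl)
    (scanLoop-spec elts elts< xs _ base L s
      -- The second offset is read after `index` has been overwritten, so `x` must be a different
      -- variable; `x<` ensures this.
      (trans (cong (λ i → arr σ offs (suc i)) (update-other (var σ) _ (separates (below 9) refl x<))) end≡) Q))))))
  where
  arith : ∀ k → 3 + (4 + (k * 26 + 4)) ≡ k * 26 + 11
  arith = solve-∀

-- Breadth-first search from one bag.

process : Cmd
process = vertex ≔ newElts [ reg head ] ⨾ head ≔ inc (reg head) ⨾ scan adjOffs adjElts vertex

-- `stop` freezes the end of the current frontier while `tail` moves on, so that a round advances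
-- the radius by exactly one.
round : Cmd
round = stop ≔ reg tail ⨾ while (reg stop ⊖ reg head) process ⨾ level ≔ reg level ⊖ lit 1

-- a ⊖ (a ⊖ b) is the minimum of a and b, so the test is the conjunction of a ≠ 0 and b ≠ 0.
levels : Cmd
levels = while (reg level ⊖ (reg level ⊖ (reg tail ⊖ reg head))) round

module _ {n : ℕ} (G : Graph n) where
  open Graph G

  Ball-mono : ∀ {r s S v} → r ≤ s → Ball G r S v → Ball G s S v
  Ball-mono r≤s (x , x∈S , l , l≤r , p) = x , x∈S , l , ≤-trans l≤r r≤s , p

  Ball-step : ∀ {r S u v} → Ball G r S u → u ~ v → Ball G (suc r) S v
  Ball-step (x , x∈S , l , l≤r , p) u~v = x , x∈S , suc l , s≤s l≤r , walk-snoc G l p u~v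

  walk-unsnoc : ∀ l {u w} → Walk G (suc l) u w → ∃[ v ] (Walk G l u v × v ~ w)
  walk-unsnoc zero    (w , u~w , refl) = _ , refl , u~w
  walk-unsnoc (suc l) (x , u~x , p) with v , q , v~w ← walk-unsnoc l p = v , (x , u~x , q) , v~w

  Ball-unstep : ∀ {r S v} → Ball G (suc r) S v → Ball G r S v ⊎ ∃[ u ] (Ball G r S u × u ~ v)
  Ball-unstep (x , x∈S , zero  , _       , p) = inj₁ (x , x∈S , 0 , z≤n , p)
  Ball-unstep (x , x∈S , suc l , s≤s l≤r , p) with u , q , u~v ← walk-unsnoc l p =
    inj₂ (u , (x , x∈S , l , l≤r , q) , u~v)

  -- This justifies stopping at an empty frontier: a set closed under adjacency that contains one
  -- ball contains all larger ones.
  Ball-closed : ∀ {ℓ S} {P : Pred (Fin n) 0ℓ} → (∀ {v} → Ball G ℓ S v → P v) →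
                (∀ {u v} → P u → u ~ v → P v) → ∀ k {v} → Ball G (k + ℓ) S v → P v
  Ball-closed base closed zero    b = base b
  Ball-closed base closed (suc k) b with Ball-unstep b
  ... | inj₁ b′               = Ball-closed base closed k b′
  ... | inj₂ (u , b′ , u~v)   = closed (Ball-closed base closed k b′) u~v

-- The test of `levels` when both a level and a frontier vertex remain.
m∸[m∸n]≢0 : ∀ m n → suc m ∸ (suc m ∸ suc n) ≢ 0
m∸[m∸n]≢0 m n eq = n≮n m (≤-trans (m∸n≡0⇒m≤n eq) (m∸n≤m m n))

record Reached {n} (base : ℕ) (P : Pred (Fin n) 0ℓ) (σ τ : State) : Set where
  field
    framed   : Frame (below 8) (below 5) σ τ
    kept     : ∀ j → j < base → arr τ newElts j ≡ arr σ newElts j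
    list     : List (Fin n)
    queue    : QueueAt τ base list
    sound    : ∀ {v} → v List.∈ list → P v
    complete : ∀ {v} → P v → v List.∈ list

module Search {n : ℕ} (G : Graph n) (adj : Fin n → List (Fin n))
              (adj⇔ : ∀ v w → (w List.∈ adj v) ⇔ Graph._~_ G v w)
              (offs elts : ℕ → ℕ)
              (adjSegment : ∀ v → Segment elts (offs (toℕ v)) (adj v))
              (adjEnd : ∀ v → offs (suc (toℕ v)) ≡ offs (toℕ v) + length (adj v)) where
  open Graph G

  HasAdj : State → Set
  HasAdj σ = arr σ adjOffs ≡ offs × arr σ adjElts ≡ elts

  hasAdj : ∀ {V σ τ} → Frame (below 8) V σ τ → HasAdj σ → HasAdj τ
  hasAdj fr (p , q) = trans (arrays fr adjOffs refl) p , trans (arrays fr adjElts refl) q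

  process-spec : ∀ y σ base L → HasAdj σ → arr σ newElts (var σ head) ≡ toℕ y → QueueAt σ base L →
                 Exec process σ (λ τ → Extends (below 7) base L (y ~_) σ τ × var τ head ≡ suc (var σ head))
                      (length (adj y) * 26 + 17)
  process-spec y σ base L (refl , refl) y≡ Q =
    exec-within (≤-reflexive (arith (length (adj y))))
    (exec-seq (exec-assign (exec-seq (exec-assign (exec-map
      (λ E → extends-from (frame-setVar head refl (frame-setVar vertex refl frame-refl)) refl refl
               (extends-⊆ (below-⊆ (m≤m+n 7 2)) (Equivalence.to (adj⇔ y _)) (Equivalence.from (adj⇔ y _)) E) ,
             variables (framed E) head refl)
      (scan-spec adjOffs adjElts vertex refl refl refl (adj y) _ base L
        (subst (λ i → Segment elts (offs i) (adj y)) (sym y≡) (adjSegment y))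
        (subst (λ i → offs (suc i) ≡ offs i + length (adj y)) (sym y≡) (adjEnd y)) Q))))))
    where
    arith : ∀ k → 3 + (3 + (k * 26 + 11)) ≡ k * 26 + 17
    arith = solve-∀

  weight : ℕ → Fin n → ℕ
  weight a v = length (adj v) * 26 + a

  -- `ys` is the unprocessed rest of the frontier. It ends at `stop`, hence no later than `tail`,
  -- and pushes write only from `tail` on, so it survives the growth of the queue. A vertex costs 17
  -- units besides its scan of neighbours, plus 4 for the loop test.
  frontier-spec : ∀ ys σ base L → HasAdj σ → Segment (arr σ newElts) (var σ head) ys →
                  var σ stop ≡ var σ head + length ys → var σ stop ≤ var σ tail → QueueAt σ base L →
                  Exec (while (reg stop ⊖ reg head) process) σ
                       (λ τ → Extends (below 7) base L (λ v → ∃[ y ] (y List.∈ ys × y ~ v)) σ τ × var τ head ≡ var σ stop)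
                       (sum (map (weight 21) ys) + 4)
  frontier-spec [] σ base L adjs s stop≡ stop≤ Q =
    exec-done (trans (cong (_∸ var σ head) (trans stop≡ (+-identityʳ _))) (n∸n≡0 (var σ head)))
      (record { framed = frame-refl ; kept = λ _ _ → refl ; new = []
              ; queue = subst (QueueAt σ base) (sym (++-identityʳ L)) Q ; sound = λ ()
              ; complete = λ { (_ , () , _) } } ,
       sym (trans stop≡ (+-identityʳ _)))
  frontier-spec (y ∷ ys) σ base L adjs (sy , s) stop≡ stop≤ Q =
    exec-within (≤-reflexive (arith (length (adj y)) (sum (map (weight 21) ys))))
    (exec-repeat (λ eq → 1+n≢0 (trans (sym (trans (cong (_∸ var σ head) stop≡) (m+n∸m≡n (var σ head) _))) eq))
      (exec-map (λ {ρ} (E , head≡) →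
        exec-map (λ (F , end≡) →
            extends-⊆ (λ _ → id) (λ { (inj₁ y~v) → y , here refl , y~v ; (inj₂ (z , z∈ , z~v)) → z , there z∈ , z~v })
                      (λ { (_ , here refl , y~v) → inj₁ y~v ; (z , there z∈ , z~v) → inj₂ (z , z∈ , z~v) })
                      (extends-trans Q E F) ,
            trans end≡ (variables (framed E) stop refl))
        (frontier-spec ys ρ base (L ++ new E) (hasAdj (framed E) adjs)
          (subst (λ h → Segment (arr ρ newElts) h ys) (sym head≡)
            (segment-agree (suc (var σ head)) ys (kept E) (≤-trans (≤-reflexive (sym stop≡′)) stop≤) s))
          (trans (variables (framed E) stop refl) (trans stop≡′ (cong (_+ length ys) (sym head≡))))
          (subst (_≤ var ρ tail) (sym (variables (framed E) stop refl)) (≤-trans stop≤ (extends-tail Q E)))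
          (queue E)))
      (process-spec y σ base L adjs sy Q)))
    where
    stop≡′ : var σ stop ≡ suc (var σ head) + length ys
    stop≡′ = trans stop≡ (+-suc (var σ head) (length ys))
    arith : ∀ k s → suc (3 + (k * 26 + 17 + (s + 4))) ≡ k * 26 + 21 + s + 4
    arith = solve-∀

  -- Processing v costs weight 21 v.  The other 18 units of weight 39 pay for one round of
  -- the search, charged to the first vertex of its nonempty frontier.
  total : ℕ
  total = sum (map (weight 39) (allFin n))

  weight-≤-total : ∀ {xs} → Unique xs → sum (map (weight 39) xs) ≤ total
  weight-≤-total uniq = unique-⊆-sum (weight 39) uniq (λ _ → ∈-allFin _)

  -- An amortised bound: `p` is the credit left after paying for `done`. As `done ++ front` has no
  -- duplicates, its weight is at most `total`, so `p` covers the frontier whatever the number `ρ`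
  -- of rounds left. The hypothesis that neighbours of `done` are already listed turns an empty
  -- frontier into closure under adjacency. The final 8 is the failing test.
  levels-spec : ∀ S ρ σ base done front ℓ p → HasAdj σ → var σ level ≡ ρ →
                var σ head ≡ base + length done → QueueAt σ base (done ++ front) →
                (∀ {v} → v List.∈ done ++ front → Ball G ℓ S v) → (∀ {v} → Ball G ℓ S v → v List.∈ done ++ front) →
                (∀ {u v} → u List.∈ done → u ~ v → v List.∈ done ++ front) →
                total ≤ sum (map (weight 39) done) + p →
                Exec levels σ (Reached base (Ball G (ρ + ℓ) S) σ) (p + 8)
  levels-spec S zero σ base done front ℓ p adjs level≡ head≡ Q sound complete closed pays =
    exec-within (m≤n+m 8 p) (exec-done
      (trans (cong (λ k → k ∸ (k ∸ (var σ tail ∸ var σ head))) level≡) (0∸n≡0 (0 ∸ (var σ tail ∸ var σ head)))) (record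
      { framed = frame-refl ; kept = λ _ _ → refl ; list = done ++ front ; queue = Q
      ; sound = sound ; complete = complete }))
  levels-spec S (suc ρ) σ base done [] ℓ p adjs level≡ head≡ Q sound complete closed pays =
    exec-within (m≤n+m 8 p) (exec-done
      (trans (cong (λ k → var σ level ∸ (var σ level ∸ k)) tail∸head) (n∸n≡0 (var σ level))) (record
      { framed = frame-refl ; kept = λ _ _ → refl ; list = done ++ [] ; queue = Q
      ; sound = Ball-mono G (m≤n+m ℓ (suc ρ)) ∘ sound
      ; complete = Ball-closed G complete (λ {u} u∈ → closed (subst (u List.∈_) (++-identityʳ done) u∈)) (suc ρ) }))
    where
    tail∸head : var σ tail ∸ var σ head ≡ 0
    tail∸head = trans (cong₂ _∸_ (trans (top≡ Q) (cong (λ l → base + length l) (++-identityʳ done))) head≡)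
                      (n∸n≡0 (base + length done))
  levels-spec S (suc ρ) σ base done front@(y ∷ ys) ℓ p adjs level≡ head≡ Q sound₀ complete₀ closed pays =
    exec-within budget
    (exec-repeat (λ eq → m∸[m∸n]≢0 ρ (length ys) (trans (sym (cong₂ (λ a b → a ∸ (a ∸ b)) level≡ tail∸head)) eq))
    (exec-seq (exec-assign (exec-seq (exec-map (λ {χ} (E , head′) → exec-assign
      (exec-map (λ R → record
          { framed   = frame-trans (frame-trans (frame-setVar stop refl frame-refl)
                         (frame-⊆ (λ _ → id) (below-⊆ (m≤m+n 5 2)) (framed E)))
                         (frame-trans (frame-setVar level refl frame-refl) (Reached.framed R))
          ; kept     = λ j j< → trans (Reached.kept R j j<) (kept E j (≤-trans j< base≤tail))
          ; list     = Reached.list R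
          ; queue    = Reached.queue R
          ; sound    = λ {v} → subst (λ k → Ball G k S v) (+-suc ρ ℓ) ∘ Reached.sound R
          ; complete = λ {v} → Reached.complete R ∘ subst (λ k → Ball G k S v) (sym (+-suc ρ ℓ))
          })
        (levels-spec S ρ (setVar χ level (var χ level ∸ 1)) base (done ++ front) (new E) (suc ℓ) p′
          (hasAdj (framed E) adjs)
          (cong (_∸ 1) (trans (variables (framed E) level refl) level≡))
          (trans head′ (top≡ Q))
          (queue E)
          (sound′ E) (complete′ E) (closed′ E)
          pays′)))
      (frontier-spec front _ base (done ++ front) adjs
        (subst (λ h → Segment (arr σ newElts) h front) (sym head≡) (segment-++⁻ base done (stored Q)))
        (trans tail≡ (cong (_+ length front) (sym head≡))) ≤-refl Q))))))
    where
    open ≤-Reasoning hiding (stop)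
    tail≡ : var σ tail ≡ base + length done + length front
    tail≡ = trans (top≡ Q) (trans (cong (base +_) (length-++ done)) (sym (+-assoc base _ _)))
    base≤tail : base ≤ var σ tail
    base≤tail = ≤-trans (m≤m+n base _) (≤-reflexive (sym (top≡ Q)))
    tail∸head : var σ tail ∸ var σ head ≡ suc (length ys)
    tail∸head = trans (cong₂ _∸_ tail≡ head≡) (m+n∸m≡n (base + length done) _)
    ΣD ΣF p′ : ℕ
    ΣD = sum (map (weight 39) done)
    ΣF = sum (map (weight 39) front)
    p′ = p ∸ ΣF
    Σ-++ : sum (map (weight 39) (done ++ front)) ≡ ΣD + ΣF
    Σ-++ = trans (cong sum (map-++ (weight 39) done front)) (sum-++ (map (weight 39) done) _)
    ΣF≤p : ΣF ≤ p
    ΣF≤p = +-cancelˡ-≤ ΣD ΣF p (≤-trans (subst (_≤ total) Σ-++ (weight-≤-total (unique Q))) pays)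
    pays′ : total ≤ sum (map (weight 39) (done ++ front)) + p′
    pays′ = begin
      total                      ≤⟨ pays ⟩
      ΣD + p                     ≡⟨ cong (ΣD +_) (m+[n∸m]≡n ΣF≤p) ⟨
      ΣD + (ΣF + p′)             ≡⟨ +-assoc ΣD ΣF p′ ⟨
      ΣD + ΣF + p′               ≡⟨ cong (_+ p′) Σ-++ ⟨
      sum (map (weight 39) (done ++ front)) + p′ ∎
    -- The 18 extra units of `y` pay 8 for the outer test, 2 for setting `stop`, 4 for the failing
    -- inner test and 4 for lowering `level`.
    budget : suc (7 + (2 + (sum (map (weight 21) front) + 4 + 4) + (p′ + 8))) ≤ p + 8
    budget = begin
      suc (7 + (2 + (weight 21 y + sum (map (weight 21) ys) + 4 + 4) + (p′ + 8)))
        ≡⟨ arith (length (adj y)) (sum (map (weight 21) ys)) p′ ⟩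
      weight 39 y + sum (map (weight 21) ys) + p′ + 8
        ≤⟨ +-monoˡ-≤ 8 (+-monoˡ-≤ p′ (+-monoʳ-≤ (weight 39 y)
             (sum-map-mono (λ v → +-monoʳ-≤ (length (adj v) * 26) (m≤m+n 21 18)) ys))) ⟩
      ΣF + p′ + 8
        ≡⟨ cong (_+ 8) (m+[n∸m]≡n ΣF≤p) ⟩
      p + 8 ∎
      where
      arith : ∀ k s q → suc (7 + (2 + (k * 26 + 21 + s + 4 + 4) + (q + 8))) ≡ k * 26 + 39 + s + q + 8
      arith = solve-∀
    Next : Pred (Fin n) 0ℓ
    Next v = ∃[ y ] (y List.∈ front × y ~ v)
    module _ {χ χ′} (E : Extends (below 7) base (done ++ front) Next χ χ′) where
      sound′ : ∀ {v} → v List.∈ (done ++ front) ++ new E → Ball G (suc ℓ) S v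
      sound′ v∈ with ∈-++⁻ (done ++ front) v∈
      ... | inj₁ p = Ball-mono G (n≤1+n ℓ) (sound₀ p)
      ... | inj₂ p with u , u∈ , u~v ← sound E p = Ball-step G (sound₀ (∈-++⁺ʳ done u∈)) u~v
      closed′ : ∀ {u v} → u List.∈ done ++ front → u ~ v → v List.∈ (done ++ front) ++ new E
      closed′ u∈ u~v with ∈-++⁻ done u∈
      ... | inj₁ p = ∈-++⁺ˡ (closed p u~v)
      ... | inj₂ p = complete E (_ , p , u~v)
      complete′ : ∀ {v} → Ball G (suc ℓ) S v → v List.∈ (done ++ front) ++ new E
      complete′ b with Ball-unstep G b
      ... | inj₁ b′             = ∈-++⁺ˡ (complete₀ b′)
      ... | inj₂ (u , b′ , u~v) = closed′ (complete₀ b′) u~v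

-- One search per tree node.

-- A single set of `StoresSets`, lying wholly below `bound`. Since new bags are only appended, the
-- bound is what carries finished bags through later searches.
record Stored {n} (offs elts : ℕ → ℕ) (P : Pred (Fin n) 0ℓ) (i bound : ℕ) : Set where
  field
    list    : List (Fin n)
    distinct : Unique list
    members : ∀ v → (v List.∈ list) ⇔ P v
    next    : offs (suc i) ≡ offs i + length list
    segment : Segment elts (offs i) list
    next≤   : offs (suc i) ≤ bound

stored-agree : ∀ {n o e o′ e′ i b b′} {P : Pred (Fin n) 0ℓ} → (∀ j → j ≤ suc i → o′ j ≡ o j) →
               (∀ j → j < b → e′ j ≡ e j) → b ≤ b′ → Stored o e P i b → Stored o′ e′ P i b′
stored-agree {o = o} {e} {o′} {e′} {i} o′≡ e′≡ b≤b′ S = record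
  { list = list ; distinct = distinct ; members = members
  ; next = trans (o′≡ (suc i) ≤-refl) (trans next (cong (_+ length list) (sym (o′≡ i (n≤1+n i)))))
  ; segment = subst (λ k → Segment e′ k list) (sym (o′≡ i (n≤1+n i)))
                (segment-agree (o i) list e′≡ (≤-trans (≤-reflexive (sym next)) next≤) segment)
  ; next≤ = ≤-trans (≤-reflexive (o′≡ (suc i) ≤-refl)) (≤-trans next≤ b≤b′)
  }
  where open Stored S

nodeStep : Cmd
nodeStep = head ≔ reg tail ⨾ scan bagOffs bagElts node ⨾ level ≔ reg radius ⨾ levels ⨾
           newOffs [ inc (reg node) ]≔ reg tail ⨾ node ≔ inc (reg node)

computeBags : Cmd
computeBags = while (reg nodeCount ⊖ reg node) nodeStep

module Nodes {n m : ℕ} (G : Graph n) (adj : Fin n → List (Fin n))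
             (adj⇔ : ∀ v w → (w List.∈ adj v) ⇔ Graph._~_ G v w) (bag : Fin m → Subset n)
             (list : Fin m → List (Fin n)) (listUnique : ∀ t → Unique (list t))
             (list⇔ : ∀ t v → (v List.∈ list t) ⇔ v ∈ bag t)
             (r : ℕ) (σ₀ : State)
             (adjSegment : ∀ v → Segment (arr σ₀ adjElts) (arr σ₀ adjOffs (toℕ v)) (adj v))
             (adjEnd : ∀ v → arr σ₀ adjOffs (suc (toℕ v)) ≡ arr σ₀ adjOffs (toℕ v) + length (adj v))
             (bagSegment : ∀ t → Segment (arr σ₀ bagElts) (arr σ₀ bagOffs (toℕ t)) (list t))
             (bagEnd : ∀ t → arr σ₀ bagOffs (suc (toℕ t)) ≡ arr σ₀ bagOffs (toℕ t) + length (list t))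
             (nodeCount≡ : var σ₀ nodeCount ≡ m) (radius≡ : var σ₀ radius ≡ r) where

  open Search G adj adj⇔ (arr σ₀ adjOffs) (arr σ₀ adjElts) adjSegment adjEnd

  -- `marks` makes the empty queue of the next search valid without clearing, and `tail≤` later
  -- bounds the cost of copying the new bags.
  record Invariant (t : ℕ) (σ : State) : Set where
    field
      framed : Frame (below 7) (below 4) σ₀ σ
      node≡  : var σ node ≡ t
      first  : arr σ newOffs 0 ≡ 0
      last   : arr σ newOffs t ≡ var σ tail
      tail≤  : var σ tail ≤ t * n
      marks  : ∀ (v : Fin n) → arr σ mark (toℕ v) ≤ t
      bags   : ∀ i → toℕ i < t → Stored (arr σ newOffs) (arr σ newElts) (Ball G r (bag i)) (toℕ i) (var σ tail)

  nodeTime : ℕ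
  nodeTime = n * 26 + total + 30

  open import Data.List.Membership.DecPropositional (Fin._≟_ {n}) using () renaming (_∈?_ to _∈ₗ?_)

  node-spec : ∀ i σ → Invariant (toℕ i) σ → Exec nodeStep σ (Invariant (suc (toℕ i))) nodeTime
  node-spec i σ I =
    exec-within budget
    (exec-seq (exec-assign (exec-seq (exec-map (λ {χ} E → exec-seq (exec-assign (exec-seq (exec-map (λ {ψ} R →
      exec-seq (exec-store (exec-assign (finish E R))))
    -- The search starts with nothing processed, the old bag as frontier, radius 0 reached and the
    -- full credit `total`.
    (levels-spec (bag i) r _ (var σ tail) [] (new E) 0 total
      (hasAdj (framed E) (arrays fr adjOffs refl , arrays fr adjElts refl))
      (trans (variables (framed E) radius refl) (trans (variables fr radius refl) radius≡))
      (trans (variables (framed E) head refl) (sym (+-identityʳ _)))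
      (queue E)
      (λ v∈ → _ , Equivalence.to (list⇔ i _) (sound E v∈) , 0 , z≤n , refl)
      (λ { (_ , v∈ , zero , z≤n , refl) → complete E (Equivalence.from (list⇔ i _) v∈) })
      (λ ()) ≤-refl)))))
    (scan-spec bagOffs bagElts node refl refl refl (list i) _ (var σ tail) []
      (subst₂ (λ e o → Segment e o (list i)) (sym (arrays fr bagElts refl)) (sym offs≡) (bagSegment i))
      (trans (cong-app (arrays fr bagOffs refl) _)
        (trans (cong (λ k → arr σ₀ bagOffs (suc k)) node≡) (trans (bagEnd i) (cong (_+ length (list i)) (sym offs≡)))))
      start)))))
    where
    open Invariant I renaming (framed to fr)
    offs≡ : arr σ bagOffs (var σ node) ≡ arr σ₀ bagOffs (toℕ i)
    offs≡ = trans (cong-app (arrays fr bagOffs refl) _) (cong (arr σ₀ bagOffs) node≡)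
    start : QueueAt (setVar σ head (var σ tail)) (var σ tail) []
    start = record { top≡ = sym (+-identityʳ _) ; stored = tt ; marked = λ ()
                   ; unmarked = λ {v} _ → subst (arr σ mark (toℕ v) ≤_) (sym node≡) (marks v) ; unique = [] }
    budget : 2 + (length (list i) * 26 + 11 + (2 + (total + 8 + (4 + 3)))) ≤ nodeTime
    budget = ≤-trans (≤-reflexive (arith (length (list i)) total))
      (+-monoˡ-≤ 30 (+-monoˡ-≤ total (*-monoˡ-≤ 26 (unique-length (listUnique i)))))
      where
      arith : ∀ k s → 2 + (k * 26 + 11 + (2 + (s + 8 + (4 + 3)))) ≡ k * 26 + s + 30
      arith = solve-∀
    finish : ∀ {χ ψ} → (E : Extends (below 9) (var σ tail) [] (List._∈ list i) (setVar σ head (var σ tail)) χ) →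
             (R : Reached (var σ tail) (Ball G (r + 0) (bag i)) (setVar χ level (var χ radius)) ψ) →
             Invariant (suc (toℕ i)) (setVar (setArr ψ newOffs (suc (var ψ node)) (var ψ tail)) node (suc (var ψ node)))
    finish {χ} {ψ} E R = record
      { framed = frame-trans (frame-trans fr (frame-⊆ (below-⊆ (m≤m+n 7 1)) (below-⊆ (m≤m+n 4 1)) toψ))
                   (frame-setVar node refl (frame-setArr newOffs refl frame-refl))
      ; node≡  = cong suc nodeψ
      ; first  = trans (update-other (arr ψ newOffs) {suc (var ψ node)} (var ψ tail) λ ()) (trans (cong-app offsψ 0) first)
      ; last   = trans (cong (λ j → update (arr ψ newOffs) (suc j) (var ψ tail) (suc (toℕ i))) nodeψ)
                   (update-same (arr ψ newOffs) (suc (toℕ i)) _)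
      ; tail≤  = begin
          var ψ tail                       ≡⟨ top≡ R.queue ⟩
          var σ tail + length R.list       ≤⟨ +-mono-≤ tail≤ (unique-length (unique R.queue)) ⟩
          toℕ i * n + n                    ≡⟨ +-comm (toℕ i * n) n ⟩
          suc (toℕ i) * n                  ∎
      ; marks  = λ v → marks′ v
      ; bags   = bags′
      }
      where
      open ≤-Reasoning hiding (stop)
      module R = Reached R
      toψ : Frame (below 8) (below 5) σ ψ
      toψ = frame-trans (frame-trans (frame-setVar head refl frame-refl) (frame-⊆ (λ _ → id) (below-⊆ (m≤m+n 5 4)) (framed E)))
              (frame-trans (frame-setVar level refl frame-refl) R.framed)
      nodeψ : var ψ node ≡ toℕ i
      nodeψ = trans (variables toψ node refl) node≡
      offsψ : arr ψ newOffs ≡ arr σ newOffs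
      offsψ = arrays toψ newOffs refl
      offs′ : ℕ → ℕ
      offs′ = update (arr ψ newOffs) (suc (var ψ node)) (var ψ tail)
      offs′≡ : ∀ j → j ≤ toℕ i → offs′ j ≡ arr σ newOffs j
      offs′≡ j j≤i = trans (update-other (arr ψ newOffs) _ (<⇒≢ (s≤s (subst (j ≤_) (sym nodeψ) j≤i)))) (cong-app offsψ j)
      offs′-next : offs′ (suc (toℕ i)) ≡ var ψ tail
      offs′-next = trans (cong (λ j → update (arr ψ newOffs) (suc j) (var ψ tail) (suc (toℕ i))) nodeψ)
                     (update-same (arr ψ newOffs) (suc (toℕ i)) _)
      kept′ : ∀ j → j < var σ tail → arr ψ newElts j ≡ arr σ newElts j
      kept′ j j< = trans (R.kept j j<) (kept E j j<)
      tail-mono : var σ tail ≤ var ψ tail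
      tail-mono = ≤-trans (m≤m+n _ _) (≤-reflexive (sym (top≡ R.queue)))
      marks′ : ∀ (v : Fin n) → arr ψ mark (toℕ v) ≤ suc (toℕ i)
      marks′ v with v ∈ₗ? R.list
      ... | yes v∈ = ≤-reflexive (trans (marked R.queue v∈) (cong suc nodeψ))
      ... | no  v∉ = ≤-trans (unmarked R.queue v∉) (≤-trans (≤-reflexive nodeψ) (n≤1+n _))
      bags′ : ∀ j → toℕ j < suc (toℕ i) → Stored offs′ (arr ψ newElts) (Ball G r (bag j)) (toℕ j) (var ψ tail)
      bags′ j (s≤s j≤i) with toℕ j ≟ toℕ i
      ... | no j≢i = stored-agree (λ k k≤ → offs′≡ k (≤-trans k≤ j<i)) kept′ tail-mono (bags j j<i)
        where
        j<i : toℕ j < toℕ i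
        j<i = ≤∧≢⇒< j≤i j≢i
      ... | yes j≡i with refl ← Fin.toℕ-injective j≡i = record
        { list    = R.list
        ; distinct = unique R.queue
        ; members = λ v → mk⇔ (subst (λ k → Ball G k (bag i) v) (+-identityʳ r) ∘ R.sound)
                              (R.complete ∘ subst (λ k → Ball G k (bag i) v) (sym (+-identityʳ r)))
        ; next    = trans offs′-next (trans (top≡ R.queue) (cong (_+ length R.list) (sym start≡)))
        ; segment = subst (λ k → Segment (arr ψ newElts) k R.list) (sym start≡) (stored R.queue)
        ; next≤   = ≤-reflexive offs′-next
        }
        where
        start≡ : offs′ (toℕ i) ≡ var σ tail
        start≡ = trans (offs′≡ (toℕ i) ≤-refl) last

  computeBags-spec : ∀ k t σ → t + k ≡ m → Invariant t σ →
                     Exec computeBags σ (Invariant m) (k * (nodeTime + 4) + 4)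
  computeBags-spec zero    t σ eq I with refl ← trans (sym (+-identityʳ t)) eq =
    exec-done (trans (cong₂ _∸_ (trans (variables (Invariant.framed I) nodeCount refl) nodeCount≡) (Invariant.node≡ I)) (n∸n≡0 t)) I
  computeBags-spec (suc k) t σ eq I =
    exec-within (≤-reflexive (arith nodeTime (k * (nodeTime + 4))))
    (exec-repeat (λ eq′ → 1+n≢0 (trans (sym (trans (cong₂ _∸_ (trans (variables (Invariant.framed I) nodeCount refl) (trans nodeCount≡ (sym eq)))
                                                               (Invariant.node≡ I)) (m+n∸m≡n t (suc k)))) eq′))
    (exec-map (λ {ρ} → computeBags-spec k (suc t) ρ (trans (sym (+-suc t k)) eq) ∘ subst (λ j → Invariant (suc j) ρ) i≡t)
    (node-spec i σ (subst (λ j → Invariant j σ) (sym i≡t) I))))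
    where
    t<m : t < m
    t<m = subst (t <_) eq (m<m+n t (s≤s z≤n))
    i : Fin m
    i = Fin.fromℕ< t<m
    i≡t : toℕ i ≡ t
    i≡t = Fin.toℕ-fromℕ< t<m
    arith : ∀ N s → suc (3 + (N + (s + 4))) ≡ N + 4 + s + 4
    arith = solve-∀

-- The complete program, its correctness and its running time.

-- The new bags are copied only now because the searches still read the old ones.
publish : Cmd
publish =
  fill bagOffs (newOffs [ reg index ]) (inc (reg nodeCount)) ⨾
  fill bagElts (newElts [ reg index ]) (reg tail) ⨾
  fill layer (layer [ reg index ] ⊘ reg exponent) (reg vertexCount)

-- The initial contents of `mark` are arbitrary, so it is cleared once; 0 is smaller than the stamp
-- of any node.
main : Cmd
main =
  fill mark (lit 0) (reg vertexCount) ⨾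
  radius ≔ reg exponent ⊘ lit 2 ⨾ tail ≔ lit 0 ⨾ newOffs [ lit 0 ]≔ lit 0 ⨾ node ≔ lit 0 ⨾
  computeBags ⨾ publish

sum-map-linear : ∀ {A : Set} (f : A → ℕ) a b xs →
                 sum (map (λ x → f x * a + b) xs) ≡ sum (map f xs) * a + length xs * b
sum-map-linear f a b []       = refl
sum-map-linear f a b (x ∷ xs) =
  trans (cong (f x * a + b +_) (sum-map-linear f a b xs)) (arith (f x) a b (sum (map f xs)) (length xs))
  where
  arith : ∀ k a b s l → k * a + b + (s * a + l * b) ≡ (k + s) * a + (b + l * b)
  arith = solve-∀

storesSets-cong : ∀ σ τ o e {m n} {P : Fin m → Pred (Fin n) 0ℓ} → arr τ o ≡ arr σ o → arr τ e ≡ arr σ e →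
                  StoresSets σ o e P → StoresSets τ o e P
storesSets-cong σ τ o e o≡ e≡ (list , uniq , mem , start , next , elems) =
  list , uniq , mem , trans (cong-app o≡ 0) start ,
  (λ i → trans (cong-app o≡ _) (trans (next i) (cong (_+ length (list i)) (sym (cong-app o≡ _))))) ,
  (λ i j → trans (cong-app e≡ _) (trans (cong (λ k → arr σ e (k + toℕ j)) (cong-app o≡ _)) (elems i j)))

module Correctness {n : ℕ} (G : Graph n) (d : ℕ) .{{_ : NonZero d}} (𝒯 : TreeDecomposition G) (ℒ : Layering G)
                   (σ : State) (storesG : StoresGraph σ G) (exponent≡ : var σ exponent ≡ d)
                   (stores𝒯 : StoresDecomposition σ 𝒯) (storesℒ : StoresLayering σ ℒ) where

  open TreeDecomposition 𝒯 using (bag) renaming (size to m; tree to treeOf)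
  open PowerDecomposition d 𝒯 ℒ

  timeBound : ℕ
  timeBound = 249 * (m * (n + ∣E∣ G))

  record Computed (τ : State) : Set where
    field
      decomposition : StoresDecomposition τ 𝒯ᵈ
      layering      : StoresLayering τ ℒᵈ

  vertexCount≡ : var σ vertexCount ≡ n
  vertexCount≡ = proj₁ storesG

  nodeCount≡ : var σ nodeCount ≡ m
  nodeCount≡ = proj₁ stores𝒯

  storesTree : StoresSets σ treeOffs treeElts (Graph._~_ treeOf)
  storesTree = proj₁ (proj₂ stores𝒯)

  -- Without vertices all bags, old and new, are empty, so the input already stores the answer.
  computed-empty : n ≡ 0 → Computed σ
  computed-empty refl = record
    { decomposition = nodeCount≡ , storesTree ,
        (let list , uniq , mem , rest = proj₂ (proj₂ stores𝒯)
         in list , uniq , (λ i ()) , rest)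
    ; layering = λ { {()} }
    }

  publish-spec : ∀ χ → Frame (below 7) (below 3) σ χ → arr χ newOffs 0 ≡ 0 →
                 (∀ i → Stored (arr χ newOffs) (arr χ newElts) (Ball G r (bag i)) (toℕ i) (var χ tail)) →
                 Exec publish χ Computed
                   (2 + (suc m * 12 + 5) + (2 + (var χ tail * 11 + 4) + (2 + (n * 13 + 4))))
  publish-spec χ fr first bags =
    exec-seq (exec-map (λ {ρ₁} (fr₁ , offs≡) → exec-seq (exec-map (λ {ρ₂} (fr₂ , elts≡) → exec-map (λ {τ} (fr₃ , layer≡) →
      let
        offsτ : ∀ j → j < suc m → arr τ bagOffs j ≡ arr χ newOffs j
        offsτ j j< = trans (cong-app (trans (arrays fr₃ bagOffs refl) (arrays fr₂ bagOffs refl)) j) (offs≡ j j<)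
        eltsτ : ∀ j → j < var χ tail → arr τ bagElts j ≡ arr χ newElts j
        eltsτ j j< = trans (cong-app (arrays fr₃ bagElts refl) j) (trans (elts≡ j j<) (cong-app (arrays fr₁ newElts refl) j))
        bagsτ : ∀ i → Stored (arr τ bagOffs) (arr τ bagElts) (Ball G r (bag i)) (toℕ i) (var χ tail)
        bagsτ i = stored-agree (λ j j≤ → offsτ j (s≤s (≤-trans j≤ (Fin.toℕ<n i)))) eltsτ ≤-refl (bags i)
      in record
        { decomposition =
            trans (variables fr₃ nodeCount refl) (trans (variables fr₂ nodeCount refl)
              (trans (variables fr₁ nodeCount refl) (trans (variables fr nodeCount refl) nodeCount≡))) ,
            storesSets-cong σ τ treeOffs treeElts
              (trans (arrays fr₃ treeOffs refl) (trans (arrays fr₂ treeOffs refl) (trans (arrays fr₁ treeOffs refl) (arrays fr treeOffs refl))))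
              (trans (arrays fr₃ treeElts refl) (trans (arrays fr₂ treeElts refl) (trans (arrays fr₁ treeElts refl) (arrays fr treeElts refl))))
              storesTree ,
            (Stored.list ∘ bagsτ) , (Stored.distinct ∘ bagsτ) ,
            (λ i v → mk⇔ (∈bagᵈ⁺ ∘ Equivalence.to (Stored.members (bagsτ i) v))
                         (Equivalence.from (Stored.members (bagsτ i) v) ∘ ∈bagᵈ⁻)) ,
            trans (offsτ 0 (s≤s z≤n)) first , (Stored.next ∘ bagsτ) ,
            (λ i → segment-lookup⁺ _ (Stored.list (bagsτ i)) (Stored.segment (bagsτ i)))
        ; layering = λ {v} {i} v∈ → trans (layer≡ (toℕ v) (Fin.toℕ<n v))
            (trans (cong (λ l → div l d) (trans (cong-app (trans (arrays fr₂ layer refl) (trans (arrays fr₁ layer refl) (arrays fr layer refl))) _)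
                                                (storesℒ (proj₂ (Layering.covering ℒ v)))))
                   (∈⟪⟫⁻ (layer? i) v∈))
        })
    (fill-spec layer _ _ ρ₂ n (λ j → div (arr ρ₂ layer j) d)
      (λ fr₃ → trans (variables fr₃ vertexCount refl) (trans (variables fr₂ vertexCount refl)
                 (trans (variables fr₁ vertexCount refl) (trans (variables fr vertexCount refl) vertexCount≡))))
      (λ {ρ} j _ fr₃ index≡ same → cong₂ div (trans (cong (arr ρ layer) index≡) same)
        (trans (variables fr₃ exponent refl) (trans (variables fr₂ exponent refl)
          (trans (variables fr₁ exponent refl) (trans (variables fr exponent refl) exponent≡)))))))
    (fill-spec bagElts _ _ ρ₁ (var χ tail) (arr ρ₁ newElts)
      (λ fr₂ → trans (variables fr₂ tail refl) (variables fr₁ tail refl))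
      (λ {ρ} j _ fr₂ index≡ _ → trans (cong-app (arrays fr₂ newElts refl) _) (cong (arr ρ₁ newElts) index≡)))))
    (fill-spec bagOffs _ _ χ (suc m) (arr χ newOffs)
      (λ fr₁ → cong suc (trans (variables fr₁ nodeCount refl) (trans (variables fr nodeCount refl) nodeCount≡)))
      (λ {ρ} j _ fr₁ index≡ _ → trans (cong-app (arrays fr₁ newOffs refl) _) (cong (arr χ newOffs) index≡))))

  start : State → State
  start ρ = setVar (setArr (setVar (setVar ρ radius (div (var ρ exponent) 2)) tail 0) newOffs 0 0) node 0

  main-spec : n ≢ 0 → Exec main σ Computed timeBound
  main-spec n≢0 with adj , adjUnique , adj⇔ , _ , adjNext , adjElems ← proj₂ storesG
                   | list , listUnique , list⇔ , _ , listNext , listElems ← proj₂ (proj₂ stores𝒯) =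
    exec-seq′
    (exec-map (λ {ρ} (fr₁ , zeros) →
      exec-seq (exec-assign (exec-seq (exec-assign (exec-seq (exec-store (exec-seq (exec-assign (exec-seq
        (let
          fr₂ : Frame (below 7) (below 3) σ (start ρ)
          fr₂ = frame-trans (frame-⊆ (below-⊆-except (m≤m+n 7 2)) (below-⊆-except (m≤m+n 3 7)) fr₁)
                  (frame-setVar node refl (frame-setArr newOffs refl (frame-setVar tail refl (frame-setVar radius refl frame-refl))))
          open Nodes G adj adj⇔ bag list listUnique list⇔ r (start ρ)
            (λ v → subst₂ (λ e o → Segment e (o (toℕ v)) (adj v)) (sym (arrays fr₂ adjElts refl)) (sym (arrays fr₂ adjOffs refl))
                     (segment-lookup⁻ _ (adj v) (adjElems v)))
            (λ v → subst (λ o → o (suc (toℕ v)) ≡ o (toℕ v) + length (adj v)) (sym (arrays fr₂ adjOffs refl)) (adjNext v))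
            (λ v → subst₂ (λ e o → Segment e (o (toℕ v)) (list v)) (sym (arrays fr₂ bagElts refl)) (sym (arrays fr₂ bagOffs refl))
                     (segment-lookup⁻ _ (list v) (listElems v)))
            (λ v → subst (λ o → o (suc (toℕ v)) ≡ o (toℕ v) + length (list v)) (sym (arrays fr₂ bagOffs refl)) (listNext v))
            (trans (variables fr₂ nodeCount refl) nodeCount≡)
            (cong (λ k → div k 2) (trans (variables fr₁ exponent refl) exponent≡))
        in exec-map (λ {χ} I → exec-within (publishTime (Invariant.tail≤ I)) (publish-spec χ
             (frame-trans fr₂ (frame-⊆ (λ _ → id) (below-⊆ (m≤m+n 3 1)) (Invariant.framed I)))
             (Invariant.first I) (λ i → Invariant.bags I i (Fin.toℕ<n i))))
           (exec-within (+-monoˡ-≤ 4 (*-monoʳ-≤ m (+-monoˡ-≤ 4 (nodeTime≤ adj adjUnique adj⇔))))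
           (computeBags-spec m 0 (start ρ) refl (record
             { framed = frame-refl ; node≡ = refl ; first = refl ; last = refl ; tail≤ = z≤n
             ; marks = λ v → ≤-reflexive (zeros (toℕ v) (Fin.toℕ<n v)) ; bags = λ i () })))))))))))))
    (fill-spec mark (lit 0) (reg vertexCount) σ n (λ _ → 0)
      (λ fr → trans (variables fr vertexCount refl) vertexCount≡) (λ _ _ _ _ _ → refl)))
    where
    E = ∣E∣ G
    -- The final `tail` depends on the state reached; its bound `m * n` from the invariant makes the
    -- cost uniform.
    publishTime : ∀ {t} → t ≤ m * n → 2 + (suc m * 12 + 5) + (2 + (t * 11 + 4) + (2 + (n * 13 + 4))) ≤
                                      2 + (suc m * 12 + 5) + (2 + (m * n * 11 + 4) + (2 + (n * 13 + 4)))
    publishTime t≤ = +-monoʳ-≤ (2 + (suc m * 12 + 5)) (+-monoˡ-≤ (2 + (n * 13 + 4)) (+-monoʳ-≤ 2 (+-monoˡ-≤ 4 (*-monoˡ-≤ 11 t≤))))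
    nodeTime≤ : ∀ adj → (∀ v → Unique (adj v)) → (∀ v w → (w List.∈ adj v) ⇔ Graph._~_ G v w) →
                n * 26 + sum (map (λ v → length (adj v) * 26 + 39) (allFin n)) + 30 ≤
                n * 26 + (2 * E * 26 + n * 39) + 30
    nodeTime≤ adj adjUnique adj⇔ = +-monoˡ-≤ 30 (+-monoʳ-≤ (n * 26) (≤-trans (≤-reflexive
      (trans (sum-map-linear (length ∘ adj) 26 39 (allFin n)) (cong (λ k → sum (map (length ∘ adj) (allFin n)) * 26 + k * 39) (length-allFin n))))
      (+-monoˡ-≤ (n * 39) (*-monoˡ-≤ 26 (handshake G adj adjUnique adj⇔)))))
    budget : 2 + (n * 10 + 4) + (4 + (2 + (3 + (2 + (m * (n * 26 + (2 * E * 26 + n * 39) + 30 + 4) + 4 +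
               (2 + (suc m * 12 + 5) + (2 + (m * n * 11 + 4) + (2 + (n * 13 + 4))))))))) ≤ timeBound
    budget = begin
      _ ≡⟨ arith m n E ⟩
      52 + 23 * n + 46 * m + 76 * (m * n) + 52 * (m * E)
        -- With `m` and `n` at least 1, the constant and the terms in `n` and `m` are absorbed by
        -- `m * n`, which reaches coefficient 197. Slack then evens it out with the 52 of `m * E`:
        -- 249 is 197 + 52.
        ≤⟨ +-mono-≤ (+-monoˡ-≤ (76 * (m * n)) (+-mono-≤
                       (+-mono-≤ (*-monoʳ-≤ 52 (*-mono-≤ 1≤m 1≤n)) (*-monoʳ-≤ 23 n≤mn)) (*-monoʳ-≤ 46 m≤mn)))
                    (m≤m+n (52 * (m * E)) (197 * (m * E) + 52 * (m * n))) ⟩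
      52 * (m * n) + 23 * (m * n) + 46 * (m * n) + 76 * (m * n) + (52 * (m * E) + (197 * (m * E) + 52 * (m * n)))
        ≡⟨ arith′ m n E ⟩
      249 * (m * (n + E)) ∎
      where
      open ≤-Reasoning hiding (stop; step-≡)
      1≤n : 1 ≤ n
      1≤n = n≢0⇒n>0 n≢0
      1≤m : 1 ≤ m
      1≤m = IsTree.nonempty (TreeDecomposition.isTree 𝒯)
      n≤mn : n ≤ m * n
      n≤mn = m≤n*m n m {{>-nonZero 1≤m}}
      m≤mn : m ≤ m * n
      m≤mn = m≤m*n m n {{>-nonZero 1≤n}}
      arith : ∀ m n E → 2 + (n * 10 + 4) + (4 + (2 + (3 + (2 + (m * (n * 26 + (2 * E * 26 + n * 39) + 30 + 4) + 4 +
               (2 + (suc m * 12 + 5) + (2 + (m * n * 11 + 4) + (2 + (n * 13 + 4))))))))) ≡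
              52 + 23 * n + 46 * m + 76 * (m * n) + 52 * (m * E)
      arith = solve-∀
      arith′ : ∀ m n E → 52 * (m * n) + 23 * (m * n) + 46 * (m * n) + 76 * (m * n) + (52 * (m * E) + (197 * (m * E) + 52 * (m * n))) ≡
               249 * (m * (n + E))
      arith′ = solve-∀
    exec-seq′ : ∀ {c₁ c₂} → Exec c₁ σ (λ ρ → Exec c₂ ρ Computed _) (2 + (n * 10 + 4)) → Exec (c₁ ⨾ c₂) σ Computed timeBound
    exec-seq′ = exec-within budget ∘ exec-seq

open TreeDecomposition using (size)

theorem3p2 : Σ[ program ∈ Cmd ] Σ[ c ∈ ℕ ]
    (∀ {n} (G : Graph n) (d : ℕ) → 2 ≤ d →
    (𝒯 : TreeDecomposition G) (ℒ : Layering G) (k : ℕ) →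
    WitnessLayeredTreewidth 𝒯 ℒ k →
    (σ : State) →
    StoresGraph σ G → var σ exponent ≡ d →
    StoresDecomposition σ 𝒯 → StoresLayering σ ℒ →
    ∃[ τ ] ∃[ time ]
    ( Run program σ τ time
    × time ≤ c * suc (size 𝒯 * (n + ∣E∣ G))
    × Σ[ 𝒯ᵈ ∈ TreeDecomposition (power G d) ] Σ[ ℒᵈ ∈ Layering (power G d) ]
    ( StoresDecomposition τ 𝒯ᵈ
    × StoresLayering τ ℒᵈ
    × size 𝒯ᵈ ≡ size 𝒯
    × (2 ∣ d → WitnessLayeredTreeIndependence 𝒯ᵈ ℒᵈ (2 * d * k))
    × (2 ∤ d → WitnessLayeredTreeIndependence 𝒯ᵈ ℒᵈ ((2 * d ∸ 1) * k)))))
-- The time bound is constant for the empty graph, whose decomposition may have any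
-- number of nodes; hence the test.
theorem3p2 = if (reg vertexCount) main skip , 249 , correct
  where
  correct : ∀ {n} (G : Graph n) (d : ℕ) → 2 ≤ d → (𝒯 : TreeDecomposition G) (ℒ : Layering G) (k : ℕ) →
            WitnessLayeredTreewidth 𝒯 ℒ k → (σ : State) → StoresGraph σ G → var σ exponent ≡ d →
            StoresDecomposition σ 𝒯 → StoresLayering σ ℒ → _
  -- Matching on `suc` provides the `NonZero d` instance; `2 ≤ d` excludes zero.
  correct {n} G d@(suc _) 2≤d 𝒯 ℒ k width σ storesG exponent≡ stores𝒯 storesℒ =
    final , steps , run , bound , 𝒯ᵈ , ℒᵈ , decomposition , (λ {v} {i} → layering {v} {i}) , refl ,
    (λ 2∣d → subst (λ w → WitnessLayeredTreeIndependence 𝒯ᵈ ℒᵈ (w * k)) (width-even 2∣d) (treeIndependence width)) ,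
    (λ 2∤d → subst (λ w → WitnessLayeredTreeIndependence 𝒯ᵈ ℒᵈ (w * k)) (width-odd 2∤d) (treeIndependence width))
    where
    open PowerDecomposition d 𝒯 ℒ
    open Correctness G d 𝒯 ℒ σ storesG exponent≡ stores𝒯 storesℒ
    result : Exec (if (reg vertexCount) main skip) σ Computed (249 * suc (size 𝒯 * (n + ∣E∣ G)))
    result with n ≟ 0
    ... | yes n≡0 = exec-within (≤-trans (m≤m+n 3 246) (m≤m*n 249 (suc (size 𝒯 * (n + ∣E∣ G)))))
                      (exec-else (trans vertexCount≡ n≡0) (exec-skip (computed-empty n≡0)))
    -- The test costs 2 units, paid from the 249 that `suc` adds to the bound.
    ... | no  n≢0 = exec-within (≤-trans (+-monoˡ-≤ timeBound (m≤m+n 2 247)) (≤-reflexive (sym (*-suc 249 (size 𝒯 * (n + ∣E∣ G))))))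
                      (exec-then (λ eq → n≢0 (trans (sym vertexCount≡) eq)) (main-spec n≢0))
    open Exec result
    open Computed post
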